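{- For every real $\mu>1$, there is no deterministic $\mu$-robust algorithm for unweighted SPPT with competitive ratio less than $2$. That is, for every $\mu>1$, every deterministic online algorithm $\mathrm{ALG}$ (which may depend on $\mu$) and every $c<2$, there is an unweighted SPPT input $Q$ with $\tilde p_q\le p_q<\mu\,\tilde p_q$ for every $q\in Q$ such that $F^{\mathrm{ALG}}(Q)>c\cdot F^{\mathrm{OPT}}(Q)$.
   Context: Unweighted scheduling with predicted processing time (SPPT), single machine. An input is a finite set $Q$ of jobs; each job $q$ has a processing time $p_q>0$, a release time $r_q\ge 0$, a predicted processing time $\tilde p_q>0$, and weight $1$. At each time the machine processes at most one released, uncompleted job, at unit rate, with preemption allowed. Job $q$ completes at the time $c_q$ at which it has received $p_q$ units of processing. The cost of a schedule is the total flow time $F=\sum_{q\in Q}(c_q-r_q)$. An online algorithm learns of $q$ only at time $r_q$, when it is told $\tilde p_q$ but not $p_q$; it observes completions when they happen, and its decisions at time $t$ depend only on information revealed up to time $t$. $F^{\mathrm{OPT}}(Q)$ is the minimum cost of an offline schedule knowing the entire input. An algorithm with a competitiveness guarantee is $\mu$-robust if the guarantee holds for all inputs with $\tilde p_q\le p_q<\mu\tilde p_q$ for every job $q$. -}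

module Defs where

open import Algebra.Bundles using (CommutativeRing)
open import Algebra.Structures using (IsCommutativeRing)
open import Data.Fin.Base using (Fin; toℕ)
open import Data.List.Base using (List; length; lookup)
open import Data.List.Relation.Unary.AllPairs using (AllPairs)
import Data.Maybe.Base as Maybe
open import Data.Maybe.Base using (Maybe; just; nothing)
open import Data.Nat.Base using (ℕ)
open import Data.Nat.GeneralisedArithmetic using (fold)
open import Data.Product.Base using (∃; ∃-syntax; _×_)
open import Data.Vec.Functional using (Vector; foldr)
open import Function.Bundles using (_⇔_)
open import Relation.Binary.PropositionalEquality.Core using (_≡_; _≢_)
open import Relation.Binary.Structures using (IsStrictTotalOrder)
open import Relation.Nullary.Construct.Add.Supremum using (_⁺; [_]; ⊤⁺)
import Algebra.Properties.Monoid.Sum as Sum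
import Relation.Binary.Construct.Add.Supremum.NonStrict as NonStrict⁺
import Relation.Binary.Construct.Add.Supremum.Strict as Strict⁺
import Relation.Binary.Construct.StrictToNonStrict as StrictToNonStrict

-- The classical axioms for the real numbers, which determine them up to
-- isomorphism.  Trichotomy with a decision is part of `IsStrictTotalOrder`.
-- `archimedean` follows classically from `complete`; it is listed because an
-- explicit natural number cannot be extracted from `complete` constructively.
record CompleteOrderedField : Set₁ where
  infixl 6 _+_ _-_
  infixl 7 _*_
  infix  8 -_
  infix  4 _<_ _≤_
  field
    Carrier             : Set
    _+_ _*_             : Carrier → Carrier → Carrier
    -_                  : Carrier → Carrier
    0# 1#               : Carrier
    _<_                 : Carrier → Carrier → Set
    isCommutativeRing   : IsCommutativeRing _≡_ _+_ _*_ -_ 0# 1#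
    0≢1                 : 0# ≢ 1#
    inverse             : ∀ x → x ≢ 0# → ∃[ y ] x * y ≡ 1#
    isStrictTotalOrder  : IsStrictTotalOrder _≡_ _<_
    +-monoˡ-<           : ∀ z {x y} → x < y → x + z < y + z
    *-pos               : ∀ {x y} → 0# < x → 0# < y → 0# < x * y

  _≤_ : Carrier → Carrier → Set
  _≤_ = StrictToNonStrict._≤_ _≡_ _<_

  _-_ : Carrier → Carrier → Carrier
  x - y = x + - y

  fromℕ : ℕ → Carrier
  fromℕ = fold 0# (1# +_)

  IsUpperBound : (Carrier → Set) → Carrier → Set
  IsUpperBound P b = ∀ x → P x → x ≤ b

  field
    archimedean : ∀ x → ∃[ n ] x < fromℕ n
    complete    : (P : Carrier → Set) → ∃ P → ∃ (IsUpperBound P) →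
                  ∃[ s ] (IsUpperBound P s × (∀ b → IsUpperBound P b → s ≤ b))

  commutativeRing : CommutativeRing _ _
  commutativeRing = record { isCommutativeRing = isCommutativeRing }

module SPPT (ℝ : CompleteOrderedField) where
  open CompleteOrderedField ℝ
  open Sum (CommutativeRing.+-monoid commutativeRing) using (sum)
  open NonStrict⁺ _≤_ public using (_≤⁺_)
  open Strict⁺ _<_ public using (_<⁺_)

  -- A countable cover of A by closed intervals of total length at most m.
  record Cover (A : Carrier → Set) (m : Carrier) : Set where
    field
      left right : ℕ → Carrier
      ordered    : ∀ k → left k ≤ right k
      covers     : ∀ t → A t → ∃[ k ] (left k ≤ t × t ≤ right k)
      total      : ∀ n → sum {n} (λ i → right (toℕ i) - left (toℕ i)) ≤ m

  OuterMeasure≤ : (Carrier → Set) → Carrier → Set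
  OuterMeasure≤ A m = ∀ ε → 0# < ε → Cover A (m + ε)

  record Job : Set where
    field
      release processing predicted : Carrier
      release≥0    : 0# ≤ release
      processing>0 : 0# < processing
      predicted>0  : 0# < predicted

  -- Jobs are numbered in order of release, so the number of a job, by which
  -- schedules and algorithms refer to it, discloses nothing about jobs that
  -- are yet to be released.
  record Input : Set where
    field
      jobs   : List Job
      sorted : AllPairs (λ a b → Job.release a ≤ Job.release b) jobs

    size : ℕ
    size = length jobs

    release processing predicted : Fin size → Carrier
    release    q = Job.release    (lookup jobs q)
    processing q = Job.processing (lookup jobs q)
    predicted  q = Job.predicted  (lookup jobs q)

  -- c is the first time at which w reaches p; ⊤⁺ if w never does.
  FirstReaches : Carrier → (Carrier → Carrier) → Carrier ⁺ → Set
  FirstReaches p w [ c ] = 0# ≤ c × w c ≡ p × (∀ t → 0# ≤ t → t < c → w t < p)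
  FirstReaches p w ⊤⁺    = ∀ t → 0# ≤ t → w t < p

  record Schedule (Q : Input) : Set where
    open Input Q
    field
      machine : Carrier → Maybe (Fin size)
      -- `work q t` is the Lebesgue measure of the times in [0 , t) at which
      -- the machine processes q.
      work    : Fin size → Carrier → Carrier
      idle    : Carrier → Carrier
      completion : Fin size → Carrier ⁺

    During : Maybe (Fin size) → Carrier → Carrier → Set
    During d t s = 0# ≤ s × s < t × machine s ≡ d

    field
      -- The parts of a finite partition of [0 , t) have outer measures
      -- summing to at least t, with equality exactly when every part is
      -- Lebesgue measurable.  So the next three fields say that `machine` is
      -- measurable and that `work` and `idle` are the measures of its fibres.
      work-measure : ∀ q t → 0# ≤ t → OuterMeasure≤ (During (just q) t) (work q t)
      idle-measure : ∀ t → 0# ≤ t → OuterMeasure≤ (During nothing t) (idle t)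
      exhaustive   : ∀ t → 0# ≤ t → sum (λ q → work q t) + idle t ≡ t
      feasible     : ∀ t q → machine t ≡ just q →
                     release q ≤ t × work q t < processing q
      first-done   : ∀ q → FirstReaches (processing q) (work q) (completion q)

    -- Total flow time, infinite if some job never completes.
    cost : Carrier ⁺
    cost = foldr (Maybe.zipWith _+_) [ 0# ]
             (λ q → Maybe.map (_- release q) (completion q))

    -- Job number i has been released by time s, with prediction x.
    Announced : Carrier → ℕ → Carrier → Set
    Announced s i x = ∃[ q ] (toℕ q ≡ i × release q ≤ s × predicted q ≡ x)

    Completed : Carrier → ℕ → Set
    Completed s i =
      ∃[ q ] (toℕ q ≡ i × release q ≤ s × processing q ≤ work q s)

    decision : Carrier → Maybe ℕ
    decision t = Maybe.map toℕ (machine t)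

  SameHistory : ∀ {Q Q′} → Schedule Q → Schedule Q′ → Carrier → Set
  SameHistory S S′ t = ∀ s → s ≤ t → ∀ i →
      (∀ x → S.Announced s i x ⇔ S′.Announced s i x)
    × (S.Completed s i ⇔ S′.Completed s i)
    where
    module S  = Schedule S
    module S′ = Schedule S′

  -- A deterministic online algorithm, given by the schedules it produces: its
  -- decision at time t is a function of what has been revealed up to time t.
  record OnlineAlgorithm : Set where
    field
      run    : (Q : Input) → Schedule Q
      causal : ∀ Q Q′ t → SameHistory (run Q) (run Q′) t →
               Schedule.decision (run Q) t ≡ Schedule.decision (run Q′) t

    cost : Input → Carrier ⁺
    cost Q = Schedule.cost (run Q)

  Robust : Carrier → Input → Set
  Robust μ Q = ∀ q → predicted q ≤ processing q × processing q < μ * predicted q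
    where open Input Q

  -- F^OPT(Q) = v, as the greatest lower bound of the costs of all schedules.
  -- When the minimum cost exists this is that minimum.
  IsOptimalCost : Input → Carrier → Set
  IsOptimalCost Q v =
      ((S : Schedule Q) → [ v ] ≤⁺ Schedule.cost S)
    × (∀ u → ((S : Schedule Q) → [ u ] ≤⁺ Schedule.cost S) → u ≤ v)

{-# OPTIONS --safe #-}

-- In every stage two jobs with prediction s are released.  The algorithm is
-- watched, on processing times s, until it completes one of them or has spent
-- time 2s.  Then both processing times are increased by so little that neither
-- job is completed by now, while one of them could have been.  The next stage
-- uses jobs that are much shorter than everything that is left over.  After K
-- stages the algorithm has 2K unfinished jobs and an offline schedule has K.  A
-- long stream of jobs shorter than all remainders, each released when its
-- predecessor can be completed, makes the algorithm pay for 2K + 1 jobs and the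
-- offline schedule for K + 1 jobs at any time of the stream.
module Submission where

open import Defs
open import Algebra.Bundles using (CommutativeRing)
import Algebra.Properties.CommutativeMonoid.Sum as Summation
import Algebra.Properties.Ring as RingProperties
import Algebra.Properties.Semiring.Mult.TCOptimised as Multiples
open import Data.Bool.Base as Bool using (Bool; true; false; _∨_; not)
open import Data.Empty using (⊥-elim)
open import Data.Fin.Base using (Fin; zero; suc; toℕ; fromℕ<)
open import Data.Fin.Properties using (any?; suc-injective; toℕ-fromℕ<; toℕ-injective)
open import Data.Integer.Base as ℤ using (ℤ; -[1+_]; _⊖_) renaming (+_ to pos)
import Data.Integer.Properties as ℤ
open import Data.List.Base using (List; []; _∷_; _++_; length; lookup; map)
open import Data.List.Relation.Unary.All as All using (All; []; _∷_)
import Data.List.Relation.Unary.All.Properties as All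
open import Data.List.Relation.Unary.AllPairs using (AllPairs; []; _∷_)
import Data.List.Relation.Unary.AllPairs.Properties as AllPairs
import Data.Maybe.Base as Maybe
open import Data.Maybe.Base using (Maybe; just; nothing)
open import Data.Maybe.Properties using (just-injective)
open import Data.Nat.Base as ℕ using (ℕ; zero; suc)
import Data.Nat.Properties as ℕ
open import Data.Product.Base using (_×_; _,_; ∃; ∃-syntax; proj₁; proj₂)
open import Data.Sum.Base as Sum using (_⊎_; inj₁; inj₂; [_,_]′)
open import Data.Unit.Base using (⊤; tt)
open import Data.Vec.Base as Vec using (Vec; []; _∷_)
open import Data.Vec.Functional using (foldr)
open import Data.Vec.N-ary using (N-ary; _$ⁿ_)
open import Function.Base using (_∘_)
open import Function.Bundles using (_⇔_; mk⇔)
open import Relation.Binary.Definitions using (tri<; tri≈; tri>)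
open import Relation.Binary.PropositionalEquality
open import Relation.Binary.Structures using (IsStrictTotalOrder; IsTotalOrder; IsDecTotalOrder)
import Relation.Binary.Construct.Add.Supremum.NonStrict as NonStrict⁺
import Relation.Binary.Construct.Add.Supremum.Strict as Strict⁺
import Relation.Binary.Construct.StrictToNonStrict as StrictToNonStrict
open import Relation.Nullary using (Dec; yes; no; ¬_; contradiction; _×-dec_)
open import Relation.Nullary.Construct.Add.Supremum using (_⁺; [_]; ⊤⁺)
open import Tactic.RingSolver.Core.AlmostCommutativeRing using (AlmostCommutativeRing; fromCommutativeRing)
open import Tactic.RingSolver.Core.Expression using (Expr; Κ; Ι; _⊕_; _⊗_; ⊝_; _⊛_; module Eval)
open import Tactic.RingSolver.Core.Polynomial.Parameters using (RawCoeff; Homomorphism)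

-- Linear arithmetic.  A sequent holds if its hypotheses add up to its
-- conclusion, which is an identity between polynomials over ℤ and is decided
-- by evaluation; a hypothesis that is needed twice is repeated.

isZero : ℤ → Bool
isZero (pos 0) = true
isZero _     = false

integerCoefficients : RawCoeff _ _
integerCoefficients = record { rawRing = ℤ.+-*-rawRing ; isZero = isZero }

open import Tactic.RingSolver.Core.Polynomial.Base integerCoefficients
  using (Poly; κ; ι; _⊞_; _⊠_; ⊟_; _⊡_; Zero; Κ; _⊐_)

normalForm : ∀ {n} → Expr ℤ n → Poly n
normalForm (Κ x)   = κ x
normalForm (Ι i)   = ι i
normalForm (x ⊕ y) = normalForm x ⊞ normalForm y
normalForm (x ⊗ y) = normalForm x ⊠ normalForm y
normalForm (⊝ x)   = ⊟ normalForm x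
normalForm (x ⊛ k) = normalForm x ⊡ k

infixl 6 _⊖′_
_⊖′_ : ∀ {n} → Expr ℤ n → Expr ℤ n → Expr ℤ n
x ⊖′ y = x ⊕ ⊝ y

∙0 ∙1 : ∀ {n} → Expr ℤ n
∙0 = Κ (pos 0)
∙1 = Κ (pos 1)

record Inequality (n : ℕ) : Set where
  constructor inequality
  field
    strict  : Bool
    lhs rhs : Expr ℤ n

infix  4 _≲_ _≺_
infixr 3 _⇒_
infix  3 ⊢_

pattern _≲_ x y = inequality false x y
pattern _≺_ x y = inequality true x y

data Sequent (n : ℕ) : Set where
  ⊢_  : Inequality n → Sequent n
  _⇒_ : Inequality n → Sequent n → Sequent n

AddsUp : ∀ {n} → Bool → Expr ℤ n → Sequent n → Set
AddsUp s e (⊢ inequality s′ x y)   = Zero (normalForm ((y ⊖′ x) ⊖′ e)) × Bool.T (not s′ ∨ s)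
AddsUp s e (inequality s′ x y ⇒ q) = AddsUp (s ∨ s′) (e ⊕ (y ⊖′ x)) q

variables : ∀ n → Vec (Expr ℤ n) n
variables n = Vec.map Ι (Vec.allFin n)

module OrderedField (ℝ : CompleteOrderedField) where
  open CompleteOrderedField ℝ public
  private
    module R = CommutativeRing commutativeRing
  open RingProperties R.ring using (-‿distribˡ-*; -‿+-comm; -0#≈0#; -‿involutive)
  open Multiples R.semiring using (×-homo-+; ×1-homo-*; 1+×) renaming (_×_ to _•_)

  private
    open ≡-Reasoning

    ⟦_⟧ℤ : ℤ → Carrier
    ⟦ pos n ⟧ℤ      = n • 1#
    ⟦ -[1+ n ] ⟧ℤ = - (suc n • 1#)

    ⊖-homo : ∀ m n → ⟦ m ⊖ n ⟧ℤ ≡ m • 1# - n • 1#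
    ⊖-homo m zero = begin
      m • 1#          ≡⟨ R.+-identityʳ _ ⟨
      m • 1# + 0#     ≡⟨ cong ((m • 1#) +_) -0#≈0# ⟨
      m • 1# - 0#     ∎
    ⊖-homo zero (suc n) = sym (R.+-identityˡ _)
    ⊖-homo (suc m) (suc n) = begin
      ⟦ suc m ⊖ suc n ⟧ℤ            ≡⟨ cong ⟦_⟧ℤ (ℤ.[1+m]⊖[1+n]≡m⊖n m n) ⟩
      ⟦ m ⊖ n ⟧ℤ                    ≡⟨ ⊖-homo m n ⟩
      a - b                         ≡⟨ cong (_- b) (R.+-identityʳ a) ⟨
      (a + 0#) - b                  ≡⟨ cong (λ z → (a + z) - b) (R.-‿inverseʳ 1#) ⟨
      (a + (1# - 1#)) - b           ≡⟨ cong (_- b) (R.+-assoc a 1# (- 1#)) ⟨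
      ((a + 1#) - 1#) - b           ≡⟨ R.+-assoc (a + 1#) (- 1#) (- b) ⟩
      (a + 1#) + (- 1# - b)         ≡⟨ cong₂ _+_ (R.+-comm a 1#) (-‿+-comm 1# b) ⟩
      (1# + a) - (1# + b)           ≡⟨ cong₂ _-_ (1+× m 1#) (1+× n 1#) ⟨
      suc m • 1# - suc n • 1#       ∎
      where a = m • 1# ; b = n • 1#

    -‿homo : ∀ i → ⟦ ℤ.- i ⟧ℤ ≡ - ⟦ i ⟧ℤ
    -‿homo (pos zero)   = sym -0#≈0#
    -‿homo (pos (suc n))  = refl
    -‿homo (-[1+ n ]) = sym (-‿involutive _)

    +-homo : ∀ i j → ⟦ i ℤ.+ j ⟧ℤ ≡ ⟦ i ⟧ℤ + ⟦ j ⟧ℤ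
    +-homo (pos m)      (pos n)      = ×-homo-+ 1# m n
    +-homo (pos m)      (-[1+ n ]) = ⊖-homo m (suc n)
    +-homo (-[1+ m ]) (pos n)      = trans (⊖-homo n (suc m)) (R.+-comm _ _)
    +-homo (-[1+ m ]) (-[1+ n ]) = begin
      ⟦ -[1+ m ] ℤ.+ -[1+ n ] ⟧ℤ                ≡⟨ cong ⟦_⟧ℤ
          (ℤ.neg-distrib-+ (pos (suc m)) (pos (suc n))) ⟨
      ⟦ ℤ.- (pos (suc m) ℤ.+ pos (suc n)) ⟧ℤ            ≡⟨ -‿homo (pos (suc m) ℤ.+ pos (suc n)) ⟩
      - ⟦ pos (suc m) ℤ.+ pos (suc n) ⟧ℤ                ≡⟨ cong -_ (×-homo-+ 1# (suc m) (suc n)) ⟩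
      - (suc m • 1# + suc n • 1#)               ≡⟨ -‿+-comm _ _ ⟨
      - (suc m • 1#) - suc n • 1#               ∎

    *-homo⁺ : ∀ m j → ⟦ pos m ℤ.* j ⟧ℤ ≡ ⟦ pos m ⟧ℤ * ⟦ j ⟧ℤ
    *-homo⁺ m (pos n) = trans (cong ⟦_⟧ℤ (sym (ℤ.pos-* m n))) (×1-homo-* m n)
    *-homo⁺ m -[1+ n ] = begin
      ⟦ pos m ℤ.* -[1+ n ] ⟧ℤ         ≡⟨ cong ⟦_⟧ℤ (ℤ.neg-distribʳ-* (pos m) (pos (suc n))) ⟨
      ⟦ ℤ.- (pos m ℤ.* pos (suc n)) ⟧ℤ    ≡⟨ -‿homo (pos m ℤ.* pos (suc n)) ⟩
      - ⟦ pos m ℤ.* pos (suc n) ⟧ℤ        ≡⟨ cong -_ (*-homo⁺ m (pos (suc n))) ⟩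
      - ((m • 1#) * (suc n • 1#))       ≡⟨ RingProperties.-‿distribʳ-* R.ring _ _ ⟩
      (m • 1#) * - (suc n • 1#)       ∎

    *-homo : ∀ i j → ⟦ i ℤ.* j ⟧ℤ ≡ ⟦ i ⟧ℤ * ⟦ j ⟧ℤ
    *-homo (pos m) j = *-homo⁺ m j
    *-homo -[1+ m ] j = begin
      ⟦ -[1+ m ] ℤ.* j ⟧ℤ           ≡⟨ cong ⟦_⟧ℤ (ℤ.neg-distribˡ-* (pos (suc m)) j) ⟨
      ⟦ ℤ.- (pos (suc m) ℤ.* j) ⟧ℤ      ≡⟨ -‿homo (pos (suc m) ℤ.* j) ⟩
      - ⟦ pos (suc m) ℤ.* j ⟧ℤ          ≡⟨ cong -_ (*-homo⁺ (suc m) j) ⟩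
      - ((suc m • 1#) * ⟦ j ⟧ℤ)       ≡⟨ -‿distribˡ-* _ _ ⟩
      - (suc m • 1#) * ⟦ j ⟧ℤ       ∎

    almostCommutativeRing : AlmostCommutativeRing _ _
    almostCommutativeRing = fromCommutativeRing commutativeRing (λ _ → nothing)

    zero-homo : ∀ i → Bool.T (isZero i) → 0# ≡ ⟦ i ⟧ℤ
    zero-homo (pos zero) _ = refl

    homomorphism : Homomorphism _ _ _ _
    homomorphism = record
      { from          = integerCoefficients
      ; to            = almostCommutativeRing
      ; morphism      = record
        { ⟦_⟧ = ⟦_⟧ℤ ; +-homo = +-homo ; *-homo = *-homo ; -‿homo = -‿homo
        ; 0-homo = refl ; 1-homo = refl }
      ; Zero-C⟶Zero-R = zero-homo
      }

  open Eval R.rawRing ⟦_⟧ℤ using (⟦_⟧) public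

  private
    open import Tactic.RingSolver.Core.Polynomial.Semantics homomorphism renaming (⟦_⟧ to ⟦_⟧ₚ)
    open import Tactic.RingSolver.Core.Polynomial.Homomorphism homomorphism
    open import Algebra.Properties.Semiring.Exp.TCOptimised R.semiring using (^-congˡ)

    correct : ∀ {n} (e : Expr ℤ n) ρ → ⟦ normalForm e ⟧ₚ ρ ≡ ⟦ e ⟧ ρ
    correct (Κ x)   ρ = κ-hom x ρ
    correct (Ι x)   ρ = ι-hom x ρ
    correct (x ⊕ y) ρ = trans (⊞-hom (normalForm x) (normalForm y) ρ)
        (cong₂ _+_ (correct x ρ) (correct y ρ))
    correct (x ⊗ y) ρ = trans (⊠-hom (normalForm x) (normalForm y) ρ)
        (cong₂ _*_ (correct x ρ) (correct y ρ))
    correct (⊝ x)   ρ = trans (⊟-hom (normalForm x) ρ) (cong -_ (correct x ρ))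
    correct (x ⊛ k) ρ = trans (⊡-hom (normalForm x) k ρ) (^-congˡ k (correct x ρ))

    zero-polynomial : ∀ {n} (p : Poly n) ρ → Zero p → ⟦ p ⟧ₚ ρ ≡ 0#
    zero-polynomial (Κ x ⊐ _) ρ z = sym (zero-homo x z)

    vanishes : ∀ {n} (e : Expr ℤ n) ρ → Zero (normalForm e) → ⟦ e ⟧ ρ ≡ 0#
    vanishes e ρ z = trans (sym (correct e ρ)) (zero-polynomial (normalForm e) ρ z)

    difference-zero : ∀ {x y} → x - y ≡ 0# → x ≡ y
    difference-zero {x} {y} eq = begin
      x              ≡⟨ R.+-identityʳ x ⟨
      x + 0#         ≡⟨ cong (x +_) (R.-‿inverseˡ y) ⟨
      x + (- y + y)  ≡⟨ R.+-assoc x (- y) y ⟨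
      x - y + y      ≡⟨ cong (_+ y) eq ⟩
      0# + y         ≡⟨ R.+-identityˡ y ⟩
      y              ∎

  ring : ∀ {n} (ρ : Vec Carrier n) (f : N-ary n (Expr ℤ n) (Expr ℤ n × Expr ℤ n)) →
         let (x , y) = f $ⁿ variables n in
         {_ : Zero (normalForm (x ⊖′ y))} → ⟦ x ⟧ ρ ≡ ⟦ y ⟧ ρ
  ring {n} ρ f {z} = let (x , y) = f $ⁿ variables n in difference-zero (vanishes (x ⊖′ y) ρ z)

  isTotalOrder : IsTotalOrder _≡_ _≤_
  isTotalOrder = StrictToNonStrict.isTotalOrder _≡_ _<_ isStrictTotalOrder

  open IsStrictTotalOrder isStrictTotalOrder public
    using (compare; _<?_) renaming (trans to <-trans; irrefl to <-irrefl)
  open IsTotalOrder isTotalOrder public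
    using (total) renaming (refl to ≤-refl; trans to ≤-trans; antisym to ≤-antisym)
  open IsDecTotalOrder (StrictToNonStrict.isDecTotalOrder _≡_ _<_ isStrictTotalOrder) public
    using (_≤?_)

  <⇒≤ : ∀ {x y} → x < y → x ≤ y
  <⇒≤ = inj₁

  ≡⇒≤ : ∀ {x y} → x ≡ y → x ≤ y
  ≡⇒≤ = inj₂

  <-≤-trans : ∀ {x y z} → x < y → y ≤ z → x < z
  <-≤-trans = StrictToNonStrict.<-≤-trans _≡_ _<_ <-trans (λ { refl p → p })

  ≤-<-trans : ∀ {x y z} → x ≤ y → y < z → x < z
  ≤-<-trans = StrictToNonStrict.≤-<-trans _≡_ _<_ sym <-trans (λ { refl p → p })

  ≤⇒≯ : ∀ {x y} → x ≤ y → ¬ (y < x)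
  ≤⇒≯ x≤y y<x = <-irrefl refl (≤-<-trans x≤y y<x)

  ≰⇒> : ∀ {x y} → ¬ (x ≤ y) → y < x
  ≰⇒> {x} {y} x≰y with compare x y
  ... | tri< x<y _ _ = contradiction (<⇒≤ x<y) x≰y
  ... | tri≈ _ x≡y _ = contradiction (≡⇒≤ x≡y) x≰y
  ... | tri> _ _ y<x = y<x

  ≤-or-> : ∀ x y → x ≤ y ⊎ y < x
  ≤-or-> x y with x ≤? y
  ... | yes x≤y = inj₁ x≤y
  ... | no  x≰y = inj₂ (≰⇒> x≰y)

  private
    infix 4 _≤[_]_
    _≤[_]_ : Carrier → Bool → Carrier → Set
    x ≤[ false ] y = x ≤ y
    x ≤[ true  ] y = x < y

    gap : ∀ s {x y} → x ≤[ s ] y → 0# ≤[ s ] y - x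
    gap true  {x} {y} x<y = subst (_< y - x) (R.-‿inverseʳ x) (+-monoˡ-< (- x) x<y)
    gap false (inj₁ x<y)  = inj₁ (gap true x<y)
    gap false {x} (inj₂ refl) = inj₂ (sym (R.-‿inverseʳ x))

    ungap : ∀ s {x y} → 0# ≤[ s ] y - x → x ≤[ s ] y
    ungap true {x} {y} 0<y-x = subst₂ _<_ (R.+-identityˡ x) (begin
      y - x + x      ≡⟨ R.+-assoc y (- x) x ⟩
      y + (- x + x)  ≡⟨ cong (y +_) (R.-‿inverseˡ x) ⟩
      y + 0#         ≡⟨ R.+-identityʳ y ⟩
      y              ∎) (+-monoˡ-< x 0<y-x)
    ungap false (inj₁ 0<y-x) = inj₁ (ungap true 0<y-x)
    ungap false (inj₂ 0≡y-x) = inj₂ (sym (difference-zero (sym 0≡y-x)))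

    weaken : ∀ s s′ {x y} → Bool.T (not s′ ∨ s) → x ≤[ s ] y → x ≤[ s′ ] y
    weaken true  true  _ p = p
    weaken true  false _ p = inj₁ p
    weaken false false _ p = p

    plus : ∀ s s′ {x y} → 0# ≤[ s ] x → 0# ≤[ s′ ] y → 0# ≤[ s ∨ s′ ] x + y
    plus true  true  {x} {y} 0<x 0<y  =
      <-trans 0<y (subst (_< x + y) (R.+-identityˡ y) (+-monoˡ-< y 0<x))
    plus true  false 0<x (inj₁ 0<y)   = plus true true 0<x 0<y
    plus true  false {x} 0<x (inj₂ refl) = subst (0# <_) (sym (R.+-identityʳ x)) 0<x
    plus false true  (inj₁ 0<x) 0<y   = plus true true 0<x 0<y
    plus false true  {y = y} (inj₂ refl) 0<y  = subst (0# <_) (sym (R.+-identityˡ y)) 0<y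
    plus false false (inj₁ 0<x) 0≤y   = inj₁ (plus true false 0<x 0≤y)
    plus false false {y = y} (inj₂ refl) 0≤y  = subst (0# ≤_) (sym (R.+-identityˡ y)) 0≤y

  ⟦_⟧⊢ : ∀ {n} → Sequent n → Vec Carrier n → Set
  ⟦ ⊢ inequality s x y   ⟧⊢ ρ = ⟦ x ⟧ ρ ≤[ s ] ⟦ y ⟧ ρ
  ⟦ inequality s x y ⇒ q ⟧⊢ ρ = ⟦ x ⟧ ρ ≤[ s ] ⟦ y ⟧ ρ → ⟦ q ⟧⊢ ρ

  private
    addUp : ∀ {n} s (e : Expr ℤ n) q ρ → AddsUp s e q → 0# ≤[ s ] ⟦ e ⟧ ρ → ⟦ q ⟧⊢ ρ
    addUp s e (⊢ inequality s′ x y) ρ (z , w) p =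
      ungap s′ (weaken s s′ w (subst (0# ≤[ s ]_) (sym
          (difference-zero (vanishes ((y ⊖′ x) ⊖′ e) ρ z))) p))
    addUp s e (inequality s′ x y ⇒ q) ρ a p h =
      addUp (s ∨ s′) (e ⊕ (y ⊖′ x)) q ρ a (plus s s′ p (gap s′ h))

  lin : ∀ {n} (ρ : Vec Carrier n) (f : N-ary n (Expr ℤ n) (Sequent n)) →
        {_ : AddsUp false ∙0 (f $ⁿ variables n)} → ⟦ f $ⁿ variables n ⟧⊢ ρ
  lin ρ f {a} = addUp false ∙0 (f $ⁿ variables _) ρ a ≤-refl

module Analysis (ℝ : CompleteOrderedField) where
  open OrderedField ℝ public
  open Summation (CommutativeRing.+-commutativeMonoid commutativeRing) public
    using (sum; sum-cong-≗; ∑-distrib-+; ∑-comm)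

  0<1 : 0# < 1#
  0<1 with compare 0# 1#
  ... | tri< 0<1 _ _ = 0<1
  ... | tri≈ _ 0≡1 _ = contradiction 0≡1 0≢1
  ... | tri> _ _ 1<0 = subst (0# <_) (ring ([]) ((∙0 ⊖′ ∙1) ⊗ (∙0 ⊖′ ∙1) , ∙1)) (*-pos 0<-1 0<-1)
    where
    0<-1 : 0# < 0# - 1#
    0<-1 = lin ([]) (∙1 ≺ ∙0 ⇒ ⊢ ∙0 ≺ ∙0 ⊖′ ∙1) 1<0

  private
    2≢0 : 1# + 1# ≢ 0#
    2≢0 2≡0 = <-irrefl refl (lin ([]) (∙0 ≺ ∙1 ⇒ ∙0 ≺ ∙1 ⇒ ∙1 ⊕ ∙1 ≲ ∙0 ⇒ ⊢ ∙0 ≺ ∙0) 0<1 0<1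
      (≡⇒≤ 2≡0))

  ½ : Carrier
  ½ = proj₁ (inverse (1# + 1#) 2≢0)

  half : Carrier → Carrier
  half x = x * ½

  half+half : ∀ x → half x + half x ≡ x
  half+half x = begin
    x * ½ + x * ½         ≡⟨ (ring (x ∷ ½ ∷ []) (λ x ½ → x ⊗ ½ ⊕ x ⊗ ½ , x ⊗ ((∙1 ⊕ ∙1) ⊗ ½))) ⟩
    x * ((1# + 1#) * ½)   ≡⟨ cong (x *_) (proj₂ (inverse (1# + 1#) 2≢0)) ⟩
    x * 1#                ≡⟨ (ring (x ∷ []) (λ x → x ⊗ ∙1 , x)) ⟩
    x                     ∎
    where open ≡-Reasoning

  half>0 : ∀ {x} → 0# < x → 0# < half x
  half>0 {x} 0<x with ≤-or-> (half x) 0#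
  ... | inj₂ p = p
  ... | inj₁ p = contradiction 0<x (≤⇒≯ (lin (half x ∷ x ∷ []) (λ a x → a ≲ ∙0 ⇒ a ≲ ∙0 ⇒
    x ≲ a ⊕ a ⇒ ⊢ x ≲ ∙0) p p (≡⇒≤ (sym (half+half x)))))

  ≤-by-ε : ∀ {x y} → (∀ ε → 0# < ε → x ≤ y + ε) → x ≤ y
  ≤-by-ε {x} {y} f with ≤-or-> x y
  ... | inj₁ x≤y = x≤y
  ... | inj₂ y<x = contradiction d>0 (≤⇒≯ (lin (x ∷ y ∷ half d ∷ []) (λ x y a → x ≲ y ⊕ a ⇒
    x ≲ y ⊕ a ⇒ a ⊕ a ≲ x ⊖′ y ⇒ ⊢ x ⊖′ y ≲ ∙0) (f (half d) (half>0 d>0)) (f (half d) (half>0 d>0))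
    (≡⇒≤ (half+half d))))
    where
    d : Carrier
    d = x - y
    d>0 : 0# < d
    d>0 = lin (y ∷ x ∷ []) (λ y x → y ≺ x ⇒ ⊢ ∙0 ≺ x ⊖′ y) y<x

  *-monoˡ-≤ : ∀ {a x y} → 0# ≤ a → x ≤ y → a * x ≤ a * y
  *-monoˡ-≤ {x = x} {y} (inj₂ refl) _ = ≡⇒≤ (ring (x ∷ y ∷ []) (λ x y → ∙0 ⊗ x , ∙0 ⊗ y))
  *-monoˡ-≤ (inj₁ _) (inj₂ refl) = ≤-refl
  *-monoˡ-≤ {a} {x} {y} (inj₁ 0<a) (inj₁ x<y) =
    <⇒≤ (lin (a ∷ y ∷ x ∷ []) (λ a y x → ∙0 ≺ a ⊗ (y ⊖′ x) ⇒ ⊢ a ⊗ x ≺ a ⊗ y) (*-pos 0<a (lin (x ∷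
      y ∷ []) (λ x y → x ≺ y ⇒ ⊢ ∙0 ≺ y ⊖′ x) x<y)))

  fromℕ≥0 : ∀ n → 0# ≤ fromℕ n
  fromℕ≥0 zero    = ≤-refl
  fromℕ≥0 (suc n) = lin (fromℕ n ∷ []) (λ a → ∙0 ≺ ∙1 ⇒ ∙0 ≲ a ⇒ ⊢ ∙0 ≲ ∙1 ⊕ a) 0<1 (fromℕ≥0 n)

  sum-mono : ∀ {n} {f g : Fin n → Carrier} → (∀ i → f i ≤ g i) → sum f ≤ sum g
  sum-mono {zero}  h = ≤-refl
  sum-mono {suc n} {f} {g} h =
    lin (f zero ∷ g zero ∷ sum (λ i → f (suc i)) ∷ sum (λ i → g (suc i)) ∷ []) (λ a b c d → a ≲ b ⇒
      c ≲ d ⇒ ⊢ a ⊕ c ≲ b ⊕ d) (h zero) (sum-mono (λ i → h (suc i)))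

  sum-nonneg : ∀ {n} {f : Fin n → Carrier} → (∀ i → 0# ≤ f i) → 0# ≤ sum f
  sum-nonneg {zero}  h = ≤-refl
  sum-nonneg {suc n} {f} h =
    lin (f zero ∷ sum (λ i → f (suc i)) ∷ []) (λ a b → ∙0 ≲ a ⇒ ∙0 ≲ b ⇒ ⊢ ∙0 ≲ a ⊕ b) (h zero)
      (sum-nonneg (λ i → h (suc i)))

  sum-mono-at : ∀ {n} {f g : Fin n → Carrier} i {d} →
                (∀ j → f j ≤ g j) → f i + d ≤ g i → sum f + d ≤ sum g
  sum-mono-at {f = f} {g} zero {d} h p =
    lin (f zero ∷ d ∷ g zero ∷ sum (λ i → f (suc i)) ∷ sum (λ i → g (suc i)) ∷ [])
      (λ a d b c e → a ⊕ d ≲ b ⇒ c ≲ e ⇒ ⊢ a ⊕ c ⊕ d ≲ b ⊕ e) p (sum-mono (λ i → h (suc i)))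
  sum-mono-at {f = f} {g} (suc i) {d} h p =
    lin (f zero ∷ g zero ∷ sum (λ i → f (suc i)) ∷ d ∷ sum (λ i → g (suc i)) ∷ [])
      (λ a b c d e → a ≲ b ⇒ c ⊕ d ≲ e ⇒ ⊢ a ⊕ c ⊕ d ≲ b ⊕ e) (h zero)
      (sum-mono-at i (λ i → h (suc i)) p)

  sum-replicate : ∀ n x → sum {n} (λ _ → x) ≡ fromℕ n * x
  sum-replicate zero    x = ring (x ∷ []) (λ x → ∙0 , ∙0 ⊗ x)
  sum-replicate (suc n) x = trans (cong (x +_) (sum-replicate n x)) (ring (x ∷ fromℕ n ∷ [])
    (λ x a → x ⊕ a ⊗ x , (∙1 ⊕ a) ⊗ x))

  partialSum : (ℕ → Carrier) → ℕ → Carrier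
  partialSum f n = sum {n} (λ i → f (toℕ i))

  partialSum-extend : ∀ (f : ℕ → Carrier) → (∀ k → 0# ≤ f k) →
                      ∀ n j → partialSum f n ≤ partialSum f (n ℕ.+ j)
  partialSum-extend f f≥0 zero    j = sum-nonneg {j} (λ i → f≥0 (toℕ i))
  partialSum-extend f f≥0 (suc n) j =
    lin (partialSum g n ∷ partialSum g (n ℕ.+ j) ∷ f 0 ∷ []) (λ a b c → a ≲ b ⇒ ⊢ c ⊕ a ≲ c ⊕ b)
      (partialSum-extend g (λ k → f≥0 (suc k)) n j)
    where
    g : ℕ → Carrier
    g k = f (suc k)

  data ReachView (l r x : Carrier) : Carrier → Set where
    before : x ≤ l → ReachView l r x 0#
    within : l ≤ x → x ≤ r → ReachView l r x (x - l)
    after  : r ≤ x → ReachView l r x (r - l)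

  abstract
    -- The length of [ l , r ] to the left of x.
    reach : Carrier → Carrier → Carrier → Carrier
    reach l r x with ≤-or-> x l | ≤-or-> x r
    ... | inj₁ _ | _      = 0#
    ... | inj₂ _ | inj₁ _ = x - l
    ... | inj₂ _ | inj₂ _ = r - l

    reachView : ∀ l r x → ReachView l r x (reach l r x)
    reachView l r x with ≤-or-> x l | ≤-or-> x r
    ... | inj₁ x≤l | _        = before x≤l
    ... | inj₂ l<x | inj₁ x≤r = within (<⇒≤ l<x) x≤r
    ... | inj₂ l<x | inj₂ r<x = after (<⇒≤ r<x)

  module _ {l r} (l≤r : l ≤ r) where
    reach≥0 : ∀ x → 0# ≤ reach l r x
    reach≥0 x with reach l r x | reachView l r x
    ... | _ | before _     = ≤-refl
    ... | _ | within l≤x _ = lin (l ∷ x ∷ []) (λ l x → l ≲ x ⇒ ⊢ ∙0 ≲ x ⊖′ l) l≤x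
    ... | _ | after _      = lin (l ∷ r ∷ []) (λ l r → l ≲ r ⇒ ⊢ ∙0 ≲ r ⊖′ l) l≤r

    reach≤length : ∀ x → reach l r x ≤ r - l
    reach≤length x with reach l r x | reachView l r x
    ... | _ | before _     = lin (l ∷ r ∷ []) (λ l r → l ≲ r ⇒ ⊢ ∙0 ≲ r ⊖′ l) l≤r
    ... | _ | within _ x≤r = lin (x ∷ r ∷ l ∷ []) (λ x r l → x ≲ r ⇒ ⊢ x ⊖′ l ≲ r ⊖′ l) x≤r
    ... | _ | after _      = ≤-refl

    reach-before : ∀ {x} → x ≤ l → reach l r x ≡ 0#
    reach-before {x} x≤l with reach l r x | reachView l r x
    ... | _ | before _     = refl
    ... | _ | within l≤x _ = ≤-antisym (lin (x ∷ l ∷ []) (λ x l → x ≲ l ⇒ ⊢ x ⊖′ l ≲ ∙0) x≤l) (lin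
      (l ∷ x ∷ []) (λ l x → l ≲ x ⇒ ⊢ ∙0 ≲ x ⊖′ l) l≤x)
    ... | _ | after r≤x    = ≤-antisym (lin (x ∷ l ∷ r ∷ []) (λ x l r → x ≲ l ⇒ r ≲ x ⇒
      ⊢ r ⊖′ l ≲ ∙0) x≤l r≤x) (lin (l ∷ r ∷ []) (λ l r → l ≲ r ⇒ ⊢ ∙0 ≲ r ⊖′ l) l≤r)

    reach-within : ∀ {x} → l ≤ x → x ≤ r → reach l r x ≡ x - l
    reach-within {x} l≤x x≤r with reach l r x | reachView l r x
    ... | _ | before x≤l = ≤-antisym (lin (l ∷ x ∷ []) (λ l x → l ≲ x ⇒ ⊢ ∙0 ≲ x ⊖′ l) l≤x) (lin
      (x ∷ l ∷ []) (λ x l → x ≲ l ⇒ ⊢ x ⊖′ l ≲ ∙0) x≤l)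
    ... | _ | within _ _ = refl
    ... | _ | after r≤x  = ≤-antisym (lin (r ∷ x ∷ l ∷ []) (λ r x l → r ≲ x ⇒ ⊢ r ⊖′ l ≲ x ⊖′ l)
      r≤x) (lin (x ∷ r ∷ l ∷ []) (λ x r l → x ≲ r ⇒ ⊢ x ⊖′ l ≲ r ⊖′ l) x≤r)

    reach-after : ∀ {x} → r ≤ x → reach l r x ≡ r - l
    reach-after {x} r≤x with reach l r x | reachView l r x
    ... | _ | before x≤l   = ≤-antisym (lin (l ∷ r ∷ []) (λ l r → l ≲ r ⇒ ⊢ ∙0 ≲ r ⊖′ l) l≤r) (lin
      (r ∷ x ∷ l ∷ []) (λ r x l → r ≲ x ⇒ x ≲ l ⇒ ⊢ r ⊖′ l ≲ ∙0) r≤x x≤l)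
    ... | _ | within _ x≤r = ≤-antisym (lin (x ∷ r ∷ l ∷ []) (λ x r l → x ≲ r ⇒ ⊢ x ⊖′ l ≲ r ⊖′ l)
      x≤r) (lin (r ∷ x ∷ l ∷ []) (λ r x l → r ≲ x ⇒ ⊢ r ⊖′ l ≲ x ⊖′ l) r≤x)
    ... | _ | after _      = refl

    reach-mono : ∀ {x y} → x ≤ y → reach l r x ≤ reach l r y
    reach-mono {x} {y} x≤y with reach l r x | reachView l r x
    ... | _ | before _       = reach≥0 y
    ... | _ | after r≤x      = ≡⇒≤ (sym (reach-after (≤-trans r≤x x≤y)))
    ... | _ | within l≤x x≤r = [ (λ y≤r → (lin (y ∷ l ∷ reach l r y ∷ x ∷ [])
      (λ y l a x → y ⊖′ l ≲ a ⇒ x ≲ y ⇒ ⊢ x ⊖′ l ≲ a)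
      (≡⇒≤ (sym (reach-within (≤-trans l≤x x≤y) y≤r))) x≤y))
                              , (λ r<y → (lin (r ∷ l ∷ reach l r y ∷ x ∷ [])
                                (λ r l a x → r ⊖′ l ≲ a ⇒ x ≲ r ⇒ ⊢ x ⊖′ l ≲ a)
                                (≡⇒≤ (sym (reach-after (<⇒≤ r<y)))) x≤r))
                              ]′ (≤-or-> y r)

  geometric : Carrier → ℕ → Carrier
  geometric ε zero    = half ε
  geometric ε (suc k) = geometric (half ε) k

  geometric>0 : ∀ {ε} → 0# < ε → ∀ k → 0# < geometric ε k
  geometric>0 0<ε zero    = half>0 0<ε
  geometric>0 0<ε (suc k) = geometric>0 (half>0 0<ε) k

  partialSum-geometric : ∀ {ε} → 0# < ε → ∀ n → partialSum (geometric ε) n ≤ ε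
  partialSum-geometric 0<ε zero = <⇒≤ 0<ε
  partialSum-geometric {ε} 0<ε (suc n) =
    lin (partialSum (geometric (half ε)) n ∷ half ε ∷ ε ∷ []) (λ a b ε → a ≲ b ⇒ b ⊕ b ≲ ε ⇒
      ⊢ b ⊕ a ≲ ε) (partialSum-geometric (half>0 0<ε) n) (≡⇒≤ (half+half ε))

  minimum : ∀ x y → ∃[ m ] (m ≤ x × m ≤ y × (m ≡ x ⊎ m ≡ y))
  minimum x y with total x y
  ... | inj₁ x≤y = x , ≤-refl , x≤y , inj₁ refl
  ... | inj₂ y≤x = y , y≤x , ≤-refl , inj₂ refl

module Measure (ℝ : CompleteOrderedField) where
  open Analysis ℝ public
  open SPPT ℝ public

  open Cover

  outerMeasure-mono : ∀ {A B m} → (∀ {t} → A t → B t) → OuterMeasure≤ B m → OuterMeasure≤ A m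
  outerMeasure-mono A⊆B μB ε 0<ε = record
    { left = C .left ; right = C .right ; ordered = C .ordered
    ; covers = λ t → C .covers t ∘ A⊆B ; total = C .total }
    where C = μB ε 0<ε

  outerMeasure-weaken : ∀ {A m m′} → m ≤ m′ → OuterMeasure≤ A m → OuterMeasure≤ A m′
  outerMeasure-weaken {m = m} {m′} m≤m′ μA ε 0<ε = record
    { left = C .left ; right = C .right ; ordered = C .ordered ; covers = C .covers
    ; total = λ n → ≤-trans (C .total n) (lin (m ∷ m′ ∷ ε ∷ []) (λ m m′ ε → m ≲ m′ ⇒
      ⊢ m ⊕ ε ≲ m′ ⊕ ε) m≤m′) }
    where C = μA ε 0<ε

  interleave : ∀ {X : Set} → (ℕ → X) → (ℕ → X) → ℕ → X
  interleave f g zero    = f zero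
  interleave f g (suc k) = interleave g (f ∘ suc) k

  module _ {X : Set} where
    interleave-all : (P : X → Set) (f g : ℕ → X) → (∀ k → P (f k)) → (∀ k → P (g k)) →
                     ∀ k → P (interleave f g k)
    interleave-all P f g Pf Pg zero    = Pf zero
    interleave-all P f g Pf Pg (suc k) = interleave-all P g (f ∘ suc) Pg (Pf ∘ suc) k

    interleave-∋ˡ : (f g : ℕ → X) → ∀ k → ∃[ j ] interleave f g j ≡ f k
    interleave-∋ʳ : (f g : ℕ → X) → ∀ k → ∃[ j ] interleave f g j ≡ g k
    interleave-∋ˡ f g zero    = zero , refl
    interleave-∋ˡ f g (suc k) = let (j , eq) = interleave-∋ʳ g (f ∘ suc) k in suc j , eq
    interleave-∋ʳ f g k       = let (j , eq) = interleave-∋ˡ g (f ∘ suc) k in suc j , eq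

    interleave-∘ : ∀ {Y : Set} (h : X → Y) (f g : ℕ → X) k →
                   h (interleave f g k) ≡ interleave (h ∘ f) (h ∘ g) k
    interleave-∘ h f g zero    = refl
    interleave-∘ h f g (suc k) = interleave-∘ h g (f ∘ suc) k

  partialSum-interleave : ∀ (f g : ℕ → Carrier) → (∀ k → 0# ≤ f k) → (∀ k → 0# ≤ g k) →
                          ∀ n → partialSum (interleave f g) n ≤ partialSum f n + partialSum g n
  partialSum-interleave f g f≥0 g≥0 zero    = ≡⇒≤ (ring ([]) (∙0 , ∙0 ⊕ ∙0))
  partialSum-interleave f g f≥0 g≥0 (suc n) =
    lin (partialSum (interleave g (f ∘ suc)) n ∷ partialSum g n ∷ partialSum (f ∘ suc) n ∷
      partialSum g (suc n) ∷ f zero ∷ []) (λ a b c d e → a ≲ b ⊕ c ⇒ b ≲ d ⇒ ⊢ e ⊕ a ≲ e ⊕ c ⊕ d)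
      (partialSum-interleave g (f ∘ suc) g≥0 (f≥0 ∘ suc) n)
      (subst (λ k → partialSum g n ≤ partialSum g k) (ℕ.+-comm n 1) (partialSum-extend g g≥0 n 1))

  outerMeasure-∪ : ∀ {A B a b} → OuterMeasure≤ A a → OuterMeasure≤ B b →
                   OuterMeasure≤ (λ t → A t ⊎ B t) (a + b)
  outerMeasure-∪ {A} {B} {a} {b} μA μB ε 0<ε = record
    { left    = proj₁ ∘ intervals
    ; right   = proj₂ ∘ intervals
    ; ordered = interleave-all (λ (l , r) → l ≤ r) (interval C) (interval D) (C .ordered) (D .ordered)
    ; covers  = λ t → [ coveredˡ t , coveredʳ t ]′
    ; total   = λ n → ≤-trans
        (≡⇒≤ (sum-cong-≗ {n} (λ i → interleave-∘ extent (interval C) (interval D) (toℕ i))))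
        (≤-trans (partialSum-interleave (extent ∘ interval C) (extent ∘ interval D) (extent≥0 C)
            (extent≥0 D) n)
          (lin (partialSum (extent ∘ interval C) n ∷ a ∷ half ε ∷
            partialSum (extent ∘ interval D) n ∷ b ∷ ε ∷ []) (λ c a d e b ε → c ≲ a ⊕ d ⇒
            e ≲ b ⊕ d ⇒ d ⊕ d ≲ ε ⇒ ⊢ c ⊕ e ≲ a ⊕ b ⊕ ε) (C .total n) (D .total n)
            (≡⇒≤ (half+half ε))))
    }
    where
    C = μA (half ε) (half>0 0<ε)
    D = μB (half ε) (half>0 0<ε)

    interval : ∀ {A m} → Cover A m → ℕ → Carrier × Carrier
    interval C k = C .left k , C .right k

    extent : Carrier × Carrier → Carrier
    extent (l , r) = r - l

    extent≥0 : ∀ {A m} (C : Cover A m) k → 0# ≤ extent (interval C k)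
    extent≥0 C k = lin (C .left k ∷ C .right k ∷ []) (λ a b → a ≲ b ⇒ ⊢ ∙0 ≲ b ⊖′ a) (C .ordered k)

    intervals : ℕ → Carrier × Carrier
    intervals = interleave (interval C) (interval D)

    Covers : Carrier → Carrier × Carrier → Set
    Covers t (l , r) = l ≤ t × t ≤ r

    coveredˡ : ∀ t → A t → ∃[ k ] Covers t (intervals k)
    coveredˡ t At =
      let (k , c) = C .covers t At
          (j , eq) = interleave-∋ˡ (interval C) (interval D) k
      in j , subst (Covers t) (sym eq) c

    coveredʳ : ∀ t → B t → ∃[ k ] Covers t (intervals k)
    coveredʳ t Bt =
      let (k , c) = D .covers t Bt
          (j , eq) = interleave-∋ʳ (interval C) (interval D) k
      in j , subst (Covers t) (sym eq) c

  outerMeasure-interval : ∀ {l r} → l ≤ r → OuterMeasure≤ (λ t → l ≤ t × t ≤ r) (r - l)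
  outerMeasure-interval {l} {r} l≤r ε 0<ε = record
    { left = λ _ → l ; right = end ; ordered = ordered′
    ; covers = λ t t∈ → zero , t∈ ; total = total′ }
    where
    end : ℕ → Carrier
    end zero    = r
    end (suc _) = l

    ordered′ : ∀ k → l ≤ end k
    ordered′ zero    = l≤r
    ordered′ (suc k) = ≤-refl

    empty : ∀ n → sum {n} (λ _ → l - l) ≡ 0#
    empty n = trans (sum-replicate n (l - l)) (ring (fromℕ n ∷ l ∷ []) (λ a l → a ⊗ (l ⊖′ l) , ∙0))

    total′ : ∀ n → partialSum (λ k → end k - l) n ≤ r - l + ε
    total′ zero    = lin (l ∷ r ∷ ε ∷ []) (λ l r ε → l ≲ r ⇒ ∙0 ≺ ε ⇒ ⊢ ∙0 ≲ r ⊖′ l ⊕ ε) l≤r 0<ε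
    total′ (suc n) = lin (sum {n} (λ _ → l - l) ∷ ε ∷ r ∷ l ∷ []) (λ a ε r l → a ≲ ∙0 ⇒ ∙0 ≺ ε ⇒
      ⊢ r ⊖′ l ⊕ a ≲ r ⊖′ l ⊕ ε) (≡⇒≤ (empty n)) 0<ε

  outerMeasure-∅ : ∀ {A} → (∀ {t} → ¬ A t) → OuterMeasure≤ A 0#
  outerMeasure-∅ ¬A = outerMeasure-weaken (≡⇒≤ (ring ([]) (∙0 ⊖′ ∙0 , ∙0)))
    (outerMeasure-mono (λ a → ⊥-elim (¬A a)) (outerMeasure-interval {0#} {0#} ≤-refl))

  outerMeasure-⋃ : ∀ {n} {A : Fin n → Carrier → Set} {w} → (∀ i → OuterMeasure≤ (A i) (w i)) →
                   OuterMeasure≤ (λ t → ∃[ i ] A i t) (sum w)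
  outerMeasure-⋃ {zero}  μA = outerMeasure-∅ (λ ())
  outerMeasure-⋃ {suc n} μA = outerMeasure-mono
    (λ { (zero , a) → inj₁ a ; (suc i , a) → inj₂ (i , a) })
    (outerMeasure-∪ (μA zero) (outerMeasure-⋃ (λ i → μA (suc i))))

  outerMeasure-⋃-replace : ∀ {n} {A : Fin n → Carrier → Set} {w} → (∀ i → OuterMeasure≤ (A i) (w i)) →
                           ∀ i {m} → OuterMeasure≤ (A i) m →
                           OuterMeasure≤ (λ t → ∃[ i ] A i t) (sum w - w i + m)
  outerMeasure-⋃-replace {w = w} μA zero {m} μ =
    outerMeasure-weaken (≡⇒≤ (ring (m ∷ sum (λ i → w (suc i)) ∷ w zero ∷ []) (λ m a b → m ⊕ a ,
      b ⊕ a ⊖′ b ⊕ m)))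
      (outerMeasure-mono (λ { (zero , a) → inj₁ a ; (suc i , a) → inj₂ (i , a) })
        (outerMeasure-∪ μ (outerMeasure-⋃ (λ i → μA (suc i)))))
  outerMeasure-⋃-replace {w = w} μA (suc i) {m} μ =
    outerMeasure-weaken (≡⇒≤ (ring (w zero ∷ sum (λ i → w (suc i)) ∷ w (suc i) ∷ m ∷ [])
      (λ a b c m → a ⊕ (b ⊖′ c ⊕ m) , a ⊕ b ⊖′ c ⊕ m)))
      (outerMeasure-mono (λ { (zero , a) → inj₁ a ; (suc i , a) → inj₂ (i , a) })
        (outerMeasure-∪ (μA zero) (outerMeasure-⋃-replace (λ i → μA (suc i)) i μ)))

  -- Heine–Borel without finite subcovers: with every interval of the cover
  -- enlarged to the right, let s be the supremum of the x such that the cover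
  -- has total length at least x to the left of x.  If s < t, then an interval
  -- containing s extends beyond it, and so does that property.
  private
    module _ {A m t} (C : Cover A m) (0≤t : 0# ≤ t) (A⊇ : ∀ s → 0# ≤ s → s < t → A s)
             {ε} (0<ε : 0# < ε) where
      end : ℕ → Carrier
      end k = C .right k + geometric ε k

      ordered⁺ : ∀ k → C .left k ≤ end k
      ordered⁺ k = lin (C .left k ∷ C .right k ∷ geometric ε k ∷ []) (λ a b c → a ≲ b ⇒ ∙0 ≺ c ⇒
        ⊢ a ≲ b ⊕ c) (C .ordered k) (geometric>0 0<ε k)

      reaches : Carrier → ℕ → Carrier
      reaches x k = reach (C .left k) (end k) x

      reaches≥0 : ∀ x k → 0# ≤ reaches x k
      reaches≥0 x k = reach≥0 (ordered⁺ k) x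

      Filled : Carrier → Set
      Filled x = x ≤ t × (∀ b → (∀ n → partialSum (reaches x) n ≤ b) → x ≤ b)

      filled-0 : Filled 0#
      filled-0 = 0≤t , λ b f≤b → f≤b 0

      supremum : ∃[ s ] (IsUpperBound Filled s × (∀ b → IsUpperBound Filled b → s ≤ b))
      supremum = complete Filled (0# , filled-0) (t , λ x → proj₁)

      s : Carrier
      s = proj₁ supremum

      s≤t : s ≤ t
      s≤t = proj₂ (proj₂ supremum) t (λ x → proj₁)

      0≤s : 0# ≤ s
      0≤s = proj₁ (proj₂ supremum) 0# filled-0

      filled-s : Filled s
      filled-s = s≤t , λ b f≤b → proj₂ (proj₂ supremum) b λ x Fx →
        proj₂ Fx b λ n → ≤-trans
          (sum-mono (λ (i : Fin n) → reach-mono (ordered⁺ (toℕ i)) (proj₁ (proj₂ supremum) x Fx)))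
          (f≤b n)

      s≤m+ε : s ≤ m + ε
      s≤m+ε = proj₂ filled-s (m + ε) λ n → ≤-trans
        (sum-mono {n} (λ i → ≤-trans (reach≤length (ordered⁺ (toℕ i)) s)
          (≡⇒≤ (ring (C .right (toℕ i) ∷ geometric ε (toℕ i) ∷ C .left (toℕ i) ∷ [])
            (λ a b c → a ⊕ b ⊖′ c , a ⊖′ c ⊕ b)))))
        (≤-trans (≡⇒≤ (∑-distrib-+ {n} (λ i → C .right (toℕ i) - C .left (toℕ i))
            (λ i → geometric ε (toℕ i))))
          (lin (partialSum (λ k → C .right k - C .left k) n ∷ m ∷ partialSum (geometric ε) n ∷
            ε ∷ []) (λ a m b ε → a ≲ m ⇒ b ≲ ε ⇒ ⊢ a ⊕ b ≲ m ⊕ ε) (C .total n)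
            (partialSum-geometric 0<ε n)))

      t≤s : t ≤ s
      t≤s with ≤-or-> t s
      ... | inj₁ t≤s = t≤s
      ... | inj₂ s<t = contradiction s<y (≤⇒≯ (proj₁ (proj₂ supremum) y filled-y))
        where
        k : ℕ
        k = proj₁ (C .covers s (A⊇ s 0≤s s<t))

        l≤s : C .left k ≤ s
        l≤s = proj₁ (proj₂ (C .covers s (A⊇ s 0≤s s<t)))

        s<end : s < end k
        s<end = lin (s ∷ C .right k ∷ geometric ε k ∷ []) (λ s a b → s ≲ a ⇒ ∙0 ≺ b ⇒ ⊢ s ≺ a ⊕ b)
          (proj₂ (proj₂ (C .covers s (A⊇ s 0≤s s<t)))) (geometric>0 0<ε k)

        y : Carrier
        y = proj₁ (minimum t (end k))

        y≤t : y ≤ t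
        y≤t = proj₁ (proj₂ (minimum t (end k)))

        y≤end : y ≤ end k
        y≤end = proj₁ (proj₂ (proj₂ (minimum t (end k))))

        s<y : s < y
        s<y with proj₂ (proj₂ (proj₂ (minimum t (end k))))
        ... | inj₁ y≡t   = subst (s <_) (sym y≡t) s<t
        ... | inj₂ y≡end = subst (s <_) (sym y≡end) s<end

        gain : reaches s k + (y - s) ≤ reaches y k
        gain = lin (reaches s k ∷ s ∷ C .left k ∷ y ∷ reaches y k ∷ []) (λ a s b y c → a ≲ s ⊖′ b ⇒
          y ⊖′ b ≲ c ⇒ ⊢ a ⊕ (y ⊖′ s) ≲ c) (≡⇒≤ (reach-within (ordered⁺ k) l≤s (<⇒≤ s<end)))
          (≡⇒≤ (sym (reach-within (ordered⁺ k) (≤-trans l≤s (<⇒≤ s<y)) y≤end)))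

        module _ (n : ℕ) where
          N : ℕ
          N = n ℕ.+ suc k

          k<N : k ℕ.< N
          k<N = ℕ.m≤n+m (suc k) n

          grows : partialSum (reaches s) N + (y - s) ≤ partialSum (reaches y) N
          grows = sum-mono-at (fromℕ< k<N) (λ i → reach-mono (ordered⁺ (toℕ i)) (<⇒≤ s<y))
            (subst (λ j → reaches s j + (y - s) ≤ reaches y j) (sym (toℕ-fromℕ< k<N)) gain)

        filled-y : Filled y
        filled-y = y≤t , λ b f≤b →
          (lin (s ∷ b ∷ y ∷ []) (λ s b y → s ≲ b ⊖′ (y ⊖′ s) ⇒ ⊢ y ≲ b)
            (proj₂ filled-s (b - (y - s)) (λ n → (lin (partialSum (reaches s) n ∷
            partialSum (reaches s) (N n) ∷ y ∷ s ∷ partialSum (reaches y) (N n) ∷ b ∷ [])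
            (λ a c y s d b → a ≲ c ⇒ c ⊕ (y ⊖′ s) ≲ d ⇒ d ≲ b ⇒ ⊢ a ≲ b ⊖′ (y ⊖′ s))
            (partialSum-extend (reaches s) (reaches≥0 s) n (suc k)) (grows n) (f≤b (N n))))))

      length≤ : t ≤ m + ε
      length≤ = ≤-trans t≤s s≤m+ε

  length≤outerMeasure : ∀ {A m t} → 0# ≤ t → (∀ s → 0# ≤ s → s < t → A s) → OuterMeasure≤ A m → t ≤ m
  length≤outerMeasure {m = m} {t} 0≤t A⊇ μA = ≤-by-ε λ ε 0<ε →
    (lin (t ∷ m ∷ half ε ∷ ε ∷ []) (λ t m a ε → t ≲ m ⊕ a ⊕ a ⇒ a ⊕ a ≲ ε ⇒ ⊢ t ≲ m ⊕ ε)
      (length≤ (μA (half ε) (half>0 0<ε)) 0≤t A⊇ (half>0 0<ε)) (≡⇒≤ (half+half ε)))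

  part-exact : ∀ {n} {A : Fin n → Carrier → Set} {w t} → 0# ≤ t →
               (∀ s → 0# ≤ s → s < t → ∃[ i ] A i s) →
               (∀ i → OuterMeasure≤ (A i) (w i)) → sum w ≡ t →
               ∀ i {m} → OuterMeasure≤ (A i) m → w i ≤ m
  part-exact {w = w} {t} 0≤t A⊇ μA Σw≡t i {m} μ =
    lin (t ∷ sum w ∷ w i ∷ m ∷ []) (λ t a b m → t ≲ a ⊖′ b ⊕ m ⇒ a ≲ t ⇒ ⊢ b ≲ m)
      (length≤outerMeasure 0≤t A⊇ (outerMeasure-⋃-replace μA i μ)) (≡⇒≤ Σw≡t)

module Schedules (ℝ : CompleteOrderedField) where
  open Measure ℝ public
  open NonStrict⁺ _≤_ public using ([_]; _≤⊤⁺)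

  outerMeasure≥0 : ∀ {A m} → OuterMeasure≤ A m → 0# ≤ m
  outerMeasure≥0 μA = ≤-by-ε λ ε 0<ε → Cover.total (μA ε 0<ε) 0

  FirstReaches-before : ∀ {p w c t s} → FirstReaches p w c → [ t ] ≤⁺ c → 0# ≤ s → s < t → w s < p
  FirstReaches-before {c = ⊤⁺}    f _       0≤s s<t = f _ 0≤s
  FirstReaches-before {c = [ _ ]} f [ t≤c ] 0≤s s<t = proj₂ (proj₂ f) _ 0≤s (<-≤-trans s<t t≤c)

  FirstReaches-at : ∀ {p w c t} → FirstReaches p w c → [ t ] ≤⁺ c → 0# ≤ t → w t ≤ p
  FirstReaches-at {c = ⊤⁺}    f _              0≤t = <⇒≤ (f _ 0≤t)
  FirstReaches-at {c = [ _ ]} f [ inj₁ t<c ]   0≤t = <⇒≤ (proj₂ (proj₂ f) _ 0≤t t<c)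
  FirstReaches-at {c = [ _ ]} f [ inj₂ refl ]  0≤t = ≡⇒≤ (proj₁ (proj₂ f))

  module ScheduleProperties {Q : Input} (S : Schedule Q) where
    open Input Q
    open Schedule S

    private
      Part : Carrier → Fin (suc size) → Carrier → Set
      Part t zero    = During nothing t
      Part t (suc q) = During (just q) t

      amount : Carrier → Fin (suc size) → Carrier
      amount t zero    = idle t
      amount t (suc q) = work q t

      part : ∀ t s → 0# ≤ s → s < t → ∃[ i ] Part t i s
      part t s 0≤s s<t with machine s in eq
      ... | nothing = zero  , 0≤s , s<t , eq
      ... | just q  = suc q , 0≤s , s<t , eq

      exact : ∀ {t} → 0# ≤ t → ∀ i {m} → OuterMeasure≤ (Part t i) m → amount t i ≤ m
      exact {t} 0≤t = part-exact 0≤t (part t)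
        (λ { zero → idle-measure t 0≤t ; (suc q) → work-measure q t 0≤t })
        (trans (ring (idle t ∷ sum (λ q → work q t) ∷ []) (λ a b → a ⊕ b ,
          b ⊕ a)) (exhaustive t 0≤t))

    work-exact : ∀ {q t m} → 0# ≤ t → OuterMeasure≤ (During (just q) t) m → work q t ≤ m
    work-exact 0≤t = exact 0≤t (suc _)

    work≥0 : ∀ q {t} → 0# ≤ t → 0# ≤ work q t
    work≥0 q 0≤t = outerMeasure≥0 (work-measure q _ 0≤t)

    During-extend : ∀ {d s t} → s ≤ t → ∀ {x} → During d s x → During d t x
    During-extend s≤t (0≤x , x<s , d) = 0≤x , <-≤-trans x<s s≤t , d

    work-mono : ∀ q {s t} → 0# ≤ s → s ≤ t → work q s ≤ work q t
    work-mono q 0≤s s≤t = work-exact 0≤s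
      (outerMeasure-mono (During-extend s≤t) (work-measure q _ (≤-trans 0≤s s≤t)))

    idle-mono : ∀ {s t} → 0# ≤ s → s ≤ t → idle s ≤ idle t
    idle-mono 0≤s s≤t = exact 0≤s zero
      (outerMeasure-mono (During-extend s≤t) (idle-measure _ (≤-trans 0≤s s≤t)))

    work-gained : ∀ {s t} → 0# ≤ s → s ≤ t → sum (λ q → work q t - work q s) ≤ t - s
    work-gained {s} {t} 0≤s s≤t =
      lin (sum (λ q → work q t - work q s) ∷ sum (λ q → work q s) ∷
        sum (λ q → work q t - work q s + work q s) ∷ sum (λ q → work q t) ∷ idle t ∷ t ∷ s ∷
        idle s ∷ []) (λ a b c d e t s f → a ⊕ b ≲ c ⇒ c ≲ d ⇒ d ⊕ e ≲ t ⇒ s ≲ b ⊕ f ⇒ f ≲ e ⇒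
        ⊢ a ≲ t ⊖′ s) (≡⇒≤ (sym (∑-distrib-+ (λ q → work q t - work q s) (λ q → work q s))))
        (≡⇒≤ (sum-cong-≗ (λ q → (ring (work q t ∷ work q s ∷ []) (λ a b → a ⊖′ b ⊕ b , a)))))
        (≡⇒≤ (exhaustive t (≤-trans 0≤s s≤t))) (≡⇒≤ (sym (exhaustive s 0≤s))) (idle-mono 0≤s s≤t)

    work-unreleased : ∀ q {t} → 0# ≤ t → t ≤ release q → work q t ≡ 0#
    work-unreleased q 0≤t t≤r = ≤-antisym
      (work-exact 0≤t (outerMeasure-∅ λ (_ , s<t , busy) →
        ≤⇒≯ (proj₁ (feasible _ q busy)) (<-≤-trans s<t t≤r)))
      (work≥0 q 0≤t)

    unfinished : ∀ q {t} → 0# ≤ t → work q t < processing q → [ t ] ≤⁺ completion q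
    unfinished q {t} 0≤t w<p with completion q | first-done q
    ... | ⊤⁺    | _ = _ ≤⊤⁺
    ... | [ c ] | (0≤c , w≡p , _) with ≤-or-> t c
    ...   | inj₁ t≤c = [ t≤c ]
    ...   | inj₂ c<t = contradiction (≤-<-trans (work-mono q 0≤c (<⇒≤ c<t)) w<p) (<-irrefl w≡p)

  earliest : ∀ {n} (f : Fin n → Carrier ⁺) T →
             ∃[ m ] (m ≤ T × (∀ i → [ m ] ≤⁺ f i) × (m ≡ T ⊎ ∃[ i ] f i ≡ [ m ]))
  earliest {zero}  f T = T , ≤-refl , (λ ()) , inj₁ refl
  earliest {suc n} f T with earliest (f ∘ suc) T
  ... | m , m≤T , m≤f , m∈ with f zero in eq
  ...   | ⊤⁺ = m , m≤T , (λ { zero → subst ([ m ] ≤⁺_) (sym eq) (_ ≤⊤⁺) ; (suc i) → m≤f i }) ,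
               [ inj₁ , (λ (i , e) → inj₂ (suc i , e)) ]′ m∈
  ...   | [ c ] with ≤-or-> m c
  ...     | inj₁ m≤c = m , m≤T , (λ { zero → subst ([ m ] ≤⁺_) (sym eq) [ m≤c ] ; (suc i) → m≤f i }) ,
                       [ inj₁ , (λ (i , e) → inj₂ (suc i , e)) ]′ m∈
  ...     | inj₂ c<m = c , <⇒≤ (<-≤-trans c<m m≤T) ,
                       (λ { zero → subst ([ c ] ≤⁺_) (sym eq) [ ≤-refl ]
                          ; (suc i) → ≤⁺-trans [ <⇒≤ c<m ] (m≤f i) }) ,
                       inj₂ (zero , eq)
    where ≤⁺-trans = NonStrict⁺.≤⁺-trans _≤_ ≤-trans

  -- Completions are the only feedback.  So the two runs agree up to the first
  -- completion in the run on Q′, and if that came before T, then the same job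
  -- would have been completed in the run on Q as well.
  module Indistinguishable
    (ALG : OnlineAlgorithm) (Q Q′ : Input) (T : Carrier)
    (ι : Fin (Input.size Q) → Fin (Input.size Q′))
    (ι-toℕ : ∀ q → toℕ (ι q) ≡ toℕ q)
    (ι-release : ∀ q → Input.release Q′ (ι q) ≡ Input.release Q q)
    (ι-predicted : ∀ q → Input.predicted Q′ (ι q) ≡ Input.predicted Q q)
    (ι-processing : ∀ q → Input.processing Q q ≤ Input.processing Q′ (ι q))
    (ι-onto : ∀ q′ → (∃[ q ] ι q ≡ q′) ⊎ T ≤ Input.release Q′ q′)
    where

    open OnlineAlgorithm ALG
    private
      module S  = Schedule (run Q)
      module S′ = Schedule (run Q′)
      module I  = Input Q
      module I′ = Input Q′

    module _ (unfinished : ∀ q → [ T ] ≤⁺ S.completion q) where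
      private
        module Until {m} (m≤T : m ≤ T) (unfinished′ : ∀ q → [ m ] ≤⁺ S′.completion (ι q)) where
          announced : ∀ {s} → s < m → ∀ i x → S.Announced s i x ⇔ S′.Announced s i x
          announced s<m i x = mk⇔
            (λ { (q , refl , r≤s , refl) → ι q , ι-toℕ q , subst (_≤ _) (sym (ι-release q)) r≤s ,
                ι-predicted q })
            back
            where
            back : S′.Announced _ i x → S.Announced _ i x
            back (q′ , i≡ , r≤s , x≡) with ι-onto q′
            ... | inj₁ (q , refl) = q , trans (sym (ι-toℕ q)) i≡ , subst (_≤ _) (ι-release q) r≤s ,
                trans (sym (ι-predicted q)) x≡
            ... | inj₂ T≤r = contradiction (<-≤-trans s<m (≤-trans m≤T T≤r)) (≤⇒≯ r≤s)

          ¬completed : ∀ {s} → s < m → ∀ i → ¬ S.Completed s i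
          ¬completed s<m i (q , _ , r≤s , p≤w) = contradiction
            (FirstReaches-before (S.first-done q) (unfinished q)
              (≤-trans (Job.release≥0 (lookup I.jobs q)) r≤s) (<-≤-trans s<m m≤T))
            (≤⇒≯ p≤w)

          ¬completed′ : ∀ {s} → s < m → ∀ i → ¬ S′.Completed s i
          ¬completed′ s<m i (q′ , _ , r≤s , p≤w) with ι-onto q′
          ... | inj₂ T≤r = contradiction (<-≤-trans s<m (≤-trans m≤T T≤r)) (≤⇒≯ r≤s)
          ... | inj₁ (q , refl) = contradiction
            (FirstReaches-before (S′.first-done (ι q)) (unfinished′ q)
              (≤-trans (Job.release≥0 (lookup I′.jobs (ι q))) r≤s) s<m)
            (≤⇒≯ p≤w)

          decision≡ : ∀ {t} → t < m → S.decision t ≡ S′.decision t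
          decision≡ t<m = causal Q Q′ _ λ s s≤t i →
            announced (≤-<-trans s≤t t<m) i ,
            mk⇔ (λ c → ⊥-elim (¬completed (≤-<-trans s≤t t<m) i c))
                (λ c → ⊥-elim (¬completed′ (≤-<-trans s≤t t<m) i c))

          toℕ-just : ∀ {n} {x : Maybe (Fin n)} {q} → Maybe.map toℕ x ≡ just (toℕ q) → x ≡ just q
          toℕ-just {x = just _} eq = cong just (toℕ-injective (just-injective eq))

          busy : ∀ {s q} → s < m → S.machine s ≡ just q → S′.machine s ≡ just (ι q)
          busy {q = q} s<m eq = toℕ-just (trans (sym (decision≡ s<m))
            (trans (cong (Maybe.map toℕ) eq) (cong just (sym (ι-toℕ q)))))

          busy′ : ∀ {s q} → s < m → S′.machine s ≡ just (ι q) → S.machine s ≡ just q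
          busy′ {q = q} s<m eq = toℕ-just (trans (decision≡ s<m)
            (trans (cong (Maybe.map toℕ) eq) (cong just (ι-toℕ q))))

          work≡ : ∀ q {t} → 0# ≤ t → t ≤ m → S′.work (ι q) t ≡ S.work q t
          work≡ q 0≤t t≤m = ≤-antisym
            (ScheduleProperties.work-exact (run Q′) 0≤t (outerMeasure-mono
              (λ (0≤s , s<t , b) → 0≤s , s<t , busy′ (<-≤-trans s<t t≤m) b) (S.work-measure q _ 0≤t)))
            (ScheduleProperties.work-exact (run Q) 0≤t (outerMeasure-mono
              (λ (0≤s , s<t , b) → 0≤s , s<t , busy (<-≤-trans s<t t≤m) b)
                  (S′.work-measure (ι q) _ 0≤t)))

      same-work : ∀ q {t} → 0# ≤ t → t ≤ T → S′.work (ι q) t ≡ S.work q t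
      same-work with earliest (S′.completion ∘ ι) T
      ... | m , m≤T , m≤c , inj₁ refl = Until.work≡ m≤T m≤c
      ... | m , inj₂ refl , m≤c , _ = Until.work≡ ≤-refl m≤c
      ... | m , inj₁ m<T , m≤c , inj₂ (q , c≡m) = contradiction finished (<-irrefl refl)
        where
        done : FirstReaches (I′.processing (ι q)) (S′.work (ι q)) [ m ]
        done = subst (FirstReaches _ _) c≡m (S′.first-done (ι q))

        finished : I′.processing (ι q) < I′.processing (ι q)
        finished = subst (_< _) (trans (sym (Until.work≡ (<⇒≤ m<T) m≤c q (proj₁ done) ≤-refl))
            (proj₁ (proj₂ done)))
          (<-≤-trans (FirstReaches-before (S.first-done q) (unfinished q) (proj₁ done) m<T)
              (ι-processing q))

module Plans (ℝ : CompleteOrderedField) where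
  open Schedules ℝ public

  sum-zero : ∀ {n} {f : Fin n → Carrier} → (∀ i → f i ≡ 0#) → sum f ≡ 0#
  sum-zero {n} f≡0 = trans (sum-cong-≗ f≡0) (trans (sum-replicate n 0#) (ring (fromℕ n ∷ [])
    (λ a → a ⊗ ∙0 , ∙0)))

  private
    record Split (l r a b : Carrier) : Set where
      field
        A B     : Carrier
        a≤A     : a ≤ A
        B≤b     : B ≤ b
        length≡ : B - A ≡ reach l r b - reach l r a
        inside  : A ≡ B ⊎ (l ≤ A × A ≤ B × B ≤ r)
        outside : ∀ {t} → a ≤ t → ¬ (l ≤ t × t < r) → t ≤ A ⊎ B ≤ t

    module _ {l r} (l≤r : l ≤ r) where
      upper : ∀ {b} → l ≤ b → ∃[ B ] (B ≤ b × B ≤ r × (B ≡ b ⊎ B ≡ r) × reach l r b ≡ B - l)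
      upper {b} l≤b with ≤-or-> b r
      ... | inj₁ b≤r = b , ≤-refl , b≤r , inj₁ refl , reach-within l≤r l≤b b≤r
      ... | inj₂ r<b = r , <⇒≤ r<b , ≤-refl , inj₂ refl , reach-after l≤r (<⇒≤ r<b)

      lower : ∀ {a} → a ≤ r → ∃[ A ] (a ≤ A × l ≤ A × (A ≡ a ⊎ A ≡ l) × reach l r a ≡ A - l)
      lower {a} a≤r with ≤-or-> a l
      ... | inj₁ a≤l = l , a≤l , ≤-refl , inj₂ refl , trans (reach-before l≤r a≤l) (ring (l ∷ [])
        (λ l → ∙0 , l ⊖′ l))
      ... | inj₂ l<a = a , ≤-refl , <⇒≤ l<a , inj₁ refl , reach-within l≤r (<⇒≤ l<a) a≤r

      split-trivial : ∀ {a b} → a ≤ b → reach l r b ≡ reach l r a → Split l r a b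
      split-trivial {a} {b} a≤b eq = record
        { A = a ; B = a ; a≤A = ≤-refl ; B≤b = a≤b ; inside = inj₁ refl ; outside = λ a≤t _ → inj₂ a≤t
        ; length≡ = trans (ring (a ∷ reach l r a ∷ []) (λ a b → a ⊖′ a ,
          b ⊖′ b)) (cong (_- reach l r a) (sym eq)) }

      split : ∀ {a b} → a ≤ b → Split l r a b
      split {a} {b} a≤b with ≤-or-> r a | ≤-or-> b l
      ... | inj₁ r≤a | _        = split-trivial a≤b
        (trans (reach-after l≤r (≤-trans r≤a a≤b)) (sym (reach-after l≤r r≤a)))
      ... | inj₂ _   | inj₁ b≤l = split-trivial a≤b
        (trans (reach-before l≤r b≤l) (sym (reach-before l≤r (≤-trans a≤b b≤l))))
      ... | inj₂ a<r | inj₂ l<b with upper (<⇒≤ l<b) | lower (<⇒≤ a<r)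
      ...   | B , B≤b , B≤r , B≡ , reach-b | A , a≤A , l≤A , A≡ , reach-a = record
        { A = A ; B = B ; a≤A = a≤A ; B≤b = B≤b ; inside = inj₂ (l≤A , A≤B A≡ B≡ , B≤r) ; outside =
            outside
        ; length≡ = trans (ring (B ∷ A ∷ l ∷ []) (λ B A l → B ⊖′ A ,
          B ⊖′ l ⊖′ (A ⊖′ l))) (cong₂ _-_ (sym reach-b) (sym reach-a)) }
        where
        A≤B : A ≡ a ⊎ A ≡ l → B ≡ b ⊎ B ≡ r → A ≤ B
        A≤B (inj₁ refl) (inj₁ refl) = a≤b
        A≤B (inj₁ refl) (inj₂ refl) = <⇒≤ a<r
        A≤B (inj₂ refl) (inj₁ refl) = <⇒≤ l<b
        A≤B (inj₂ refl) (inj₂ refl) = l≤r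

        outside : ∀ {t} → a ≤ t → ¬ (l ≤ t × t < r) → t ≤ A ⊎ B ≤ t
        outside {t} _ ∉ with ≤-or-> l t | ≤-or-> r t
        ... | inj₂ t<l | _        = inj₁ (≤-trans (<⇒≤ t<l) l≤A)
        ... | inj₁ _   | inj₁ r≤t = inj₂ (≤-trans B≤r r≤t)
        ... | inj₁ l≤t | inj₂ t<r = contradiction (l≤t , t<r) ∉

  Separate : Carrier → Carrier → Carrier → Carrier → Set
  Separate l r l′ r′ = r ≤ l′ ⊎ r′ ≤ l

  private
    unoccupied : ∀ {n} → (Fin n → Carrier) → (Fin n → Carrier) → Carrier → Carrier
    unoccupied l r t = t - sum (λ i → reach (l i) (r i) t)

    reach-separate : ∀ {l r l′ r′ A B} → l′ ≤ r′ → Separate l r l′ r′ →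
                     A ≡ B ⊎ (l ≤ A × A ≤ B × B ≤ r) → reach l′ r′ A ≡ reach l′ r′ B
    reach-separate _ _ (inj₁ refl) = refl
    reach-separate l′≤r′ (inj₁ r≤l′) (inj₂ (l≤A , A≤B , B≤r)) =
      trans (reach-before l′≤r′ (≤-trans A≤B (≤-trans B≤r r≤l′)))
          (sym (reach-before l′≤r′ (≤-trans B≤r r≤l′)))
    reach-separate l′≤r′ (inj₂ r′≤l) (inj₂ (l≤A , A≤B , B≤r)) =
      trans (reach-after l′≤r′ (≤-trans r′≤l l≤A))
          (sym (reach-after l′≤r′ (≤-trans r′≤l (≤-trans l≤A A≤B))))

  outerMeasure-gaps : ∀ {n} (l r : Fin n → Carrier) → (∀ i → l i ≤ r i) →
    (∀ i j → i ≢ j → Separate (l i) (r i) (l j) (r j)) → ∀ {a b} → a ≤ b →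
    OuterMeasure≤ (λ t → a ≤ t × t ≤ b × (∀ i → ¬ (l i ≤ t × t < r i)))
      (unoccupied l r b - unoccupied l r a)
  outerMeasure-gaps {zero} l r l≤r sep {a} {b} a≤b = outerMeasure-weaken
    (≡⇒≤ (ring (b ∷ a ∷ []) (λ b a → b ⊖′ a , b ⊖′ ∙0 ⊖′ (a ⊖′ ∙0))))
    (outerMeasure-mono (λ (a≤t , t≤b , _) → a≤t , t≤b) (outerMeasure-interval a≤b))
  outerMeasure-gaps {suc n} l r l≤r sep {a} {b} a≤b = outerMeasure-weaken
    (lin (reach (l zero) (r zero) b ∷ reach (l zero) (r zero) a ∷ B ∷ A ∷ Σ B ∷ Σ A ∷ a ∷ Σ a ∷ b ∷
      Σ b ∷ []) (λ c d B A e f a g b h → c ⊖′ d ≲ B ⊖′ A ⇒ e ≲ f ⇒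
      ⊢ A ⊖′ f ⊖′ (a ⊖′ g) ⊕ (b ⊖′ h ⊖′ (B ⊖′ e)) ≲ b ⊖′ (c ⊕ h) ⊖′ (a ⊖′ (d ⊕ g)))
      (≡⇒≤ (sym length≡)) (≡⇒≤ (sym same)))
    (outerMeasure-mono
      (λ (a≤t , t≤b , free) → Sum.map (λ t≤A → a≤t , t≤A , free ∘ suc)
          (λ B≤t → B≤t , t≤b , free ∘ suc) (outside a≤t (free zero)))
      (outerMeasure-∪ (rest a≤A) (rest B≤b)))
    where
    open Split (split (l≤r zero) a≤b)

    Σ : Carrier → Carrier
    Σ t = sum (λ i → reach (l (suc i)) (r (suc i)) t)

    same : Σ A ≡ Σ B
    same = sum-cong-≗ λ i → reach-separate (l≤r (suc i)) (sep zero (suc i) λ ()) inside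

    rest : ∀ {a b} → a ≤ b → OuterMeasure≤ (λ t → a ≤ t × t ≤ b ×
        (∀ i → ¬ (l (suc i) ≤ t × t < r (suc i))))
             ((b - Σ b) - (a - Σ a))
    rest = outerMeasure-gaps (l ∘ suc) (r ∘ suc) (l≤r ∘ suc)
        (λ i j i≢j → sep (suc i) (suc j) (i≢j ∘ suc-injective))

  costSum : ∀ {n} → (Fin n → Carrier ⁺) → (Fin n → Carrier) → Carrier ⁺
  costSum c r = foldr (Maybe.zipWith _+_) [ 0# ] (λ q → Maybe.map (_- r q) (c q))

  costSum-finite : ∀ {n} (c : Fin n → Carrier ⁺) (r c′ : Fin n → Carrier) → (∀ q → c q ≡ [ c′ q ]) →
                   costSum c r ≡ [ sum (λ q → c′ q - r q) ]
  costSum-finite {zero}  c r c′ h = refl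
  costSum-finite {suc n} c r c′ h =
    cong₂ (λ x y → Maybe.zipWith _+_ (Maybe.map (_- r zero) x) y) (h zero)
      (costSum-finite (c ∘ suc) (r ∘ suc) (c′ ∘ suc) (h ∘ suc))

  costSum-cases : ∀ {n} (c : Fin n → Carrier ⁺) (r : Fin n → Carrier) →
                  costSum c r ≡ ⊤⁺ ⊎ ∃ λ (c′ : Fin n → Carrier) → ∀ q → c q ≡ [ c′ q ]
  costSum-cases {zero} c r = inj₂ ((λ ()) , λ ())
  costSum-cases {suc n} c r with c zero in eq | costSum-cases (c ∘ suc) (r ∘ suc)
  ... | ⊤⁺    | _       = inj₁ refl
  ... | [ x ] | inj₁ ∞  = inj₁ (cong (Maybe.zipWith _+_ [ x - r zero ]) ∞)
  ... | [ x ] | inj₂ (c′ , h) = inj₂ ((λ { zero → x ; (suc q) → c′ q }) ,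
      λ { zero → eq ; (suc q) → h q })

  module NonPreemptive (Q : Input) (start : Fin (Input.size Q) → Carrier)
    (released : ∀ q → Input.release Q q ≤ start q)
    (separate : ∀ q q′ → q ≢ q′ → Separate (start q) (start q + Input.processing Q q) (start q′)
        (start q′ + Input.processing Q q′))
    where
    open Input Q
    private
      end : Fin size → Carrier
      end q = start q + processing q

      processing>0 : ∀ q → 0# < processing q
      processing>0 q = Job.processing>0 (lookup jobs q)

      start≤end : ∀ q → start q ≤ end q
      start≤end q = lin (processing q ∷ start q ∷ []) (λ a b → ∙0 ≺ a ⇒ ⊢ b ≲ b ⊕ a)
        (processing>0 q)

      start≥0 : ∀ q → 0# ≤ start q
      start≥0 q = ≤-trans (Job.release≥0 (lookup jobs q)) (released q)

      length≡ : ∀ q → end q - start q ≡ processing q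
      length≡ q = ring (start q ∷ processing q ∷ []) (λ a b → a ⊕ b ⊖′ a , b)

      Running : Carrier → Fin size → Set
      Running t q = start q ≤ t × t < end q

      pick : ∀ {t} → Dec (∃ (Running t)) → Maybe (Fin size)
      pick (yes (q , _)) = just q
      pick (no _)        = nothing

      running? : ∀ t → Dec (∃ (Running t))
      running? t = any? λ q → (start q ≤? t) ×-dec (t <? end q)

      pick-just : ∀ {t q} (d : Dec (∃ (Running t))) → pick d ≡ just q → Running t q
      pick-just (yes (_ , p)) refl = p

      pick-nothing : ∀ {t} (d : Dec (∃ (Running t))) → pick d ≡ nothing → ∀ q → ¬ Running t q
      pick-nothing (no ¬p) _ q p = ¬p (q , p)

      worked : Fin size → Carrier → Carrier
      worked q = reach (start q) (end q)

      worked-before-end : ∀ q {t} → t < end q → worked q t < processing q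
      worked-before-end q {t} t<end = [
          (λ t≤start → subst (_< processing q) (sym (reach-before (start≤end q) t≤start))
              (processing>0 q))
        , (λ start<t → (lin (worked q t ∷ t ∷ start q ∷ processing q ∷ []) (λ a t b c → a ≲ t ⊖′ b ⇒
          t ≺ b ⊕ c ⇒ ⊢ a ≺ c) (≡⇒≤ (reach-within (start≤end q) (<⇒≤ start<t) (<⇒≤ t<end))) t<end))
        ]′ (≤-or-> t (start q))

    schedule : Schedule Q
    schedule = record
      { machine    = λ t → pick (running? t)
      ; work       = worked
      ; idle       = λ t → t - sum (λ q → worked q t)
      ; completion = λ q → [ end q ]
      ; work-measure = λ q t 0≤t → outerMeasure-weaken
          (≡⇒≤ (ring (start q ∷ worked q t ∷ []) (λ a b → a ⊕ b ⊖′ a , b)))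
          (outerMeasure-mono
            (λ { {s} (_ , s<t , busy) → let (start≤s , s<end) = pick-just (running? s) busy in start≤s ,
                 (lin (s ∷ start q ∷ worked q s ∷ worked q t ∷ []) (λ s a b c → s ⊖′ a ≲ b ⇒ b ≲ c ⇒
                   ⊢ s ≲ a ⊕ c) (≡⇒≤ (sym (reach-within (start≤end q) start≤s (<⇒≤ s<end))))
                   (reach-mono (start≤end q) (<⇒≤ s<t))) })
            (outerMeasure-interval (lin (worked q t ∷ start q ∷ []) (λ a b → ∙0 ≲ a ⇒ ⊢ b ≲ b ⊕ a)
              (reach≥0 (start≤end q) t))))
      ; idle-measure = λ t 0≤t → outerMeasure-weaken
          (lin (sum (λ q → worked q 0#) ∷ t ∷ sum (λ q → worked q t) ∷ []) (λ a t b → a ≲ ∙0 ⇒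
            ⊢ t ⊖′ b ⊖′ (∙0 ⊖′ a) ≲ t ⊖′ b)
            (≡⇒≤ (sum-zero (λ q → reach-before (start≤end q) (start≥0 q)))))
          (outerMeasure-mono
            (λ { {s} (0≤s , s<t , idle) → 0≤s , <⇒≤ s<t , pick-nothing (running? s) idle })
            (outerMeasure-gaps start end start≤end separate 0≤t))
      ; exhaustive = λ t 0≤t → (ring (sum (λ q → worked q t) ∷ t ∷ []) (λ a t → a ⊕ (t ⊖′ a) , t))
      ; feasible   = λ t q busy → let (start≤t , t<end) = pick-just (running? t) busy in
          ≤-trans (released q) start≤t , worked-before-end q t<end
      ; first-done = λ q → ≤-trans (start≥0 q) (start≤end q)
                         , trans (reach-after (start≤end q) ≤-refl) (length≡ q)
                         , λ t _ → worked-before-end q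
      }

    schedule-cost : Schedule.cost schedule ≡ [ sum (λ q → start q + processing q - release q) ]
    schedule-cost = costSum-finite _ release end (λ _ → refl)

module Costs (ℝ : CompleteOrderedField) where
  open Plans ℝ public

  archimedean-* : ∀ {a} → 0# < a → ∀ b → ∃[ n ] b < fromℕ n * a
  archimedean-* {a} 0<a b with inverse a (λ a≡0 → <-irrefl (sym a≡0) 0<a)
  ... | y , ay≡1 with archimedean (b * y)
  ...   | n , by<n = n ,
    (lin (fromℕ n ∷ b ∷ y ∷ a ∷ []) (λ c b y a → ∙0 ≺ (c ⊖′ b ⊗ y) ⊗ a ⇒ b ≲ b ⊗ (a ⊗ y) ⇒
      ⊢ b ≺ c ⊗ a) (*-pos (lin (b ∷ y ∷ fromℕ n ∷ []) (λ b y a → b ⊗ y ≺ a ⇒ ⊢ ∙0 ≺ a ⊖′ b ⊗ y)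
      by<n) 0<a) (≡⇒≤ (sym (trans (cong (b *_) ay≡1) (ring (b ∷ []) (λ b → b ⊗ ∙1 , b))))))

  halve-≤ : ∀ {x y} → x + x ≤ y + y → x ≤ y
  halve-≤ {x} {y} 2x≤2y with ≤-or-> x y
  ... | inj₁ x≤y = x≤y
  ... | inj₂ y<x = contradiction (lin (y ∷ x ∷ []) (λ y x → y ≺ x ⇒ y ≺ x ⇒ ⊢ y ⊕ y ≺ x ⊕ x) y<x
    y<x) (≤⇒≯ 2x≤2y)

  term≤sum : ∀ {n} {f : Fin n → Carrier} → (∀ i → 0# ≤ f i) → ∀ i → f i ≤ sum f
  term≤sum {n} {f} f≥0 i =
    lin (sum {n} (λ _ → 0#) ∷ f i ∷ sum f ∷ []) (λ a b c → a ⊕ b ≲ c ⇒ ∙0 ≲ a ⇒ ⊢ b ≲ c)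
      (sum-mono-at i f≥0 (≡⇒≤ (ring (f i ∷ []) (λ a → ∙0 ⊕ a , a))))
      (≡⇒≤ (sym (sum-zero {n} (λ _ → refl))))

  module ScheduleCosts {Q : Input} (S : Schedule Q) where
    open Input Q
    open Schedule S
    open ScheduleProperties S

    work-lipschitz : ∀ q {s t} → 0# ≤ s → s ≤ t → work q t - work q s ≤ t - s
    work-lipschitz q {s} {t} 0≤s s≤t = ≤-trans
      (term≤sum {f = λ q → work q t - work q s}
        (λ q → (lin (work q s ∷ work q t ∷ []) (λ a b → a ≲ b ⇒ ⊢ ∙0 ≲ b ⊖′ a)
          (work-mono q 0≤s s≤t))) q)
      (work-gained 0≤s s≤t)

    worked⇒released : ∀ q {t} → 0# ≤ t → 0# < work q t → release q ≤ t
    worked⇒released q {t} 0≤t 0<w with ≤-or-> (release q) t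
    ... | inj₁ r≤t = r≤t
    ... | inj₂ t<r = contradiction 0<w (<-irrefl (sym (work-unreleased q 0≤t (<⇒≤ t<r))))

    module _ {c : Fin size → Carrier} (completed : ∀ q → completion q ≡ [ c q ]) where
      completes : ∀ q → FirstReaches (processing q) (work q) [ c q ]
      completes q = subst (FirstReaches _ _) (completed q) (first-done q)

      flow≥0 : 0# ≤ sum (λ q → c q - release q)
      flow≥0 = sum-nonneg λ q →
        (lin (release q ∷ c q ∷ []) (λ a b → a ≲ b ⇒ ⊢ ∙0 ≲ b ⊖′ a)
          (worked⇒released q (proj₁ (completes q))
              (subst (0# <_) (sym (proj₁ (proj₂ (completes q)))) (Job.processing>0 (lookup jobs q)))))

      -- Of two jobs, at least δ units of work are done on the one completed first
      -- until the other one is completed.  So summing over all pairs bounds the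
      -- completion times from below without sorting them.
      completions-bound : ∀ {T δ} → 0# ≤ T → 0# < δ → (∀ q → work q T + δ ≤ processing q) →
        fromℕ size * (fromℕ size * δ + δ) ≤ sum (λ q → c q - T) + sum (λ q → c q - T)
      completions-bound {T} {δ} 0≤T 0<δ remaining =
        lin (fromℕ size ∷ δ ∷ sum {size} (λ _ → fromℕ size * δ + δ) ∷
          sum (λ q → sum (λ q′ → gain q′ q + gain q q′)) ∷ sum (λ q → sum (λ q′ → gain q′ q)) ∷
          sum (λ q → sum (λ q′ → gain q q′)) ∷ sum (λ q → c q - T) ∷ [])
          (λ a δ b c d e f → a ⊗ (a ⊗ δ ⊕ δ) ≲ b ⇒ b ≲ c ⇒ c ≲ d ⊕ e ⇒ e ≲ d ⇒ d ≲ f ⇒ d ≲ f ⇒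
          ⊢ a ⊗ (a ⊗ δ ⊕ δ) ≲ f ⊕ f) (≡⇒≤ (sym (sum-replicate size (fromℕ size * δ + δ))))
          (sum-mono row)
          (≡⇒≤ (trans (sum-cong-≗ (λ q → ∑-distrib-+ (λ q′ → gain q′ q) (λ q′ → gain q q′)))
              (∑-distrib-+ (λ q → sum (λ q′ → gain q′ q)) (λ q → sum (λ q′ → gain q q′)))))
          (≡⇒≤ (∑-comm gain)) (sum-mono (λ q → work-gained 0≤T (T≤c q)))
          (sum-mono (λ q → work-gained 0≤T (T≤c q)))
        where
        gain : Fin size → Fin size → Carrier
        gain q′ q = work q′ (c q) - work q′ T

        T≤c : ∀ q → T ≤ c q
        T≤c q with ≤-or-> T (c q)
        ... | inj₁ T≤c = T≤c
        ... | inj₂ c<T = contradiction 0<δ (≤⇒≯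
          (lin (work q T ∷ δ ∷ processing q ∷ work q (c q) ∷ []) (λ a δ b c → a ⊕ δ ≲ b ⇒ b ≲ c ⇒
            c ≲ a ⇒ ⊢ δ ≲ ∙0) (remaining q) (≡⇒≤ (sym (proj₁ (proj₂ (completes q)))))
            (work-mono q (proj₁ (completes q)) (<⇒≤ c<T))))

        gain≥0 : ∀ q′ q → 0# ≤ gain q′ q
        gain≥0 q′ q = lin (work q′ T ∷ work q′ (c q) ∷ []) (λ a b → a ≲ b ⇒ ⊢ ∙0 ≲ b ⊖′ a)
          (work-mono q′ 0≤T (T≤c q))

        gain-later : ∀ q′ q → c q′ ≤ c q → δ ≤ gain q′ q
        gain-later q′ q c′≤c =
          lin (work q′ T ∷ δ ∷ processing q′ ∷ work q′ (c q′) ∷ work q′ (c q) ∷ [])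
            (λ a δ b c d → a ⊕ δ ≲ b ⇒ b ≲ c ⇒ c ≲ d ⇒ ⊢ δ ≲ d ⊖′ a) (remaining q′)
            (≡⇒≤ (sym (proj₁ (proj₂ (completes q′))))) (work-mono q′ (proj₁ (completes q′)) c′≤c)

        pair : ∀ q q′ → δ ≤ gain q′ q + gain q q′
        pair q q′ = [
            (λ c≤c′ → (lin (δ ∷ gain q q′ ∷ gain q′ q ∷ []) (λ δ a b → δ ≲ a ⇒ ∙0 ≲ b ⇒ ⊢ δ ≲ b ⊕ a)
              (gain-later q q′ c≤c′) (gain≥0 q′ q)))
          , (λ c′≤c → (lin (δ ∷ gain q′ q ∷ gain q q′ ∷ []) (λ δ a b → δ ≲ a ⇒ ∙0 ≲ b ⇒ ⊢ δ ≲ a ⊕ b)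
            (gain-later q′ q c′≤c) (gain≥0 q q′)))
          ]′ (total (c q) (c q′))

        row : ∀ q → fromℕ size * δ + δ ≤ sum (λ q′ → gain q′ q + gain q q′)
        row q = subst (λ x → x + δ ≤ sum (λ q′ → gain q′ q + gain q q′)) (sum-replicate size δ)
          (sum-mono-at q (pair q) (lin (δ ∷ gain q q ∷ []) (λ δ a → δ ≲ a ⇒ δ ≲ a ⇒ ⊢ δ ⊕ δ ≲ a ⊕ a)
            (gain-later q q ≤-refl) (gain-later q q ≤-refl)))

  optimalCost : ∀ {Q U} (S : Schedule Q) → Schedule.cost S ≡ [ U ] →
                ∃[ v ] (IsOptimalCost Q v × 0# ≤ v × v ≤ U)
  optimalCost {Q} {U} S₀ cost≡U = v , (below , λ u → proj₁ (proj₂ infimum) u) ,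
    proj₁ (proj₂ infimum) 0# nonneg , proj₂ (proj₂ infimum) U bounded
    where
    LowerBound : Carrier → Set
    LowerBound u = (S : Schedule Q) → [ u ] ≤⁺ Schedule.cost S

    finite-≤ : ∀ {x y z} → y ≡ [ z ] → [ x ] ≤⁺ y → x ≤ z
    finite-≤ refl [ x≤z ] = x≤z

    nonneg : LowerBound 0#
    nonneg S with costSum-cases (Schedule.completion S) (Input.release Q)
    ... | inj₁ ∞ = subst ([ 0# ] ≤⁺_) (sym ∞) (_ ≤⊤⁺)
    ... | inj₂ (c , h) = subst ([ 0# ] ≤⁺_) (sym (costSum-finite _ _ c h)) [ ScheduleCosts.flow≥0 S h ]

    bounded : IsUpperBound LowerBound U
    bounded u lb = finite-≤ cost≡U (lb S₀)

    infimum : ∃[ s ] (IsUpperBound LowerBound s × (∀ b → IsUpperBound LowerBound b → s ≤ b))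
    infimum = complete LowerBound (0# , nonneg) (U , bounded)

    v : Carrier
    v = proj₁ infimum

    below : LowerBound v
    below S with Schedule.cost S in eq
    ... | ⊤⁺    = _ ≤⊤⁺
    ... | [ x ] = [ proj₂ (proj₂ infimum) x (λ u lb → finite-≤ eq (lb S)) ]

module Entries (ℝ : CompleteOrderedField) where
  open Costs ℝ public

  -- In the offline schedule a job starts at a fixed time, or it is deferred
  -- until all jobs with fixed starting times are completed, with an offset.
  data Slot : Set where
    fixed deferred : Carrier → Slot

  record Entry : Set where
    constructor entry
    field
      job  : Job
      slot : Slot
    open Job job public

  open Entry

  sumOver : (Entry → Carrier) → List Entry → Carrier
  sumOver f []      = 0#
  sumOver f (e ∷ E) = f e + sumOver f E

  sumOver-++ : ∀ f E {E′} → sumOver f (E ++ E′) ≡ sumOver f E + sumOver f E′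
  sumOver-++ f [] {E′} = ring (sumOver f E′ ∷ []) (λ a → a , ∙0 ⊕ a)
  sumOver-++ f (e ∷ E) {E′} = trans (cong (f e +_) (sumOver-++ f E))
    (ring (f e ∷ sumOver f E ∷ sumOver f E′ ∷ []) (λ a b c → a ⊕ (b ⊕ c) , a ⊕ b ⊕ c))

  sumOver-mono : ∀ {P : Entry → Set} {f g} → (∀ e → P e → f e ≤ g e) → ∀ {E} → All P E →
      sumOver f E ≤ sumOver g E
  sumOver-mono h [] = ≤-refl
  sumOver-mono {f = f} {g} h {e ∷ E} (p ∷ ps) =
    lin (f e ∷ g e ∷ sumOver f E ∷ sumOver g E ∷ []) (λ a b c d → a ≲ b ⇒ c ≲ d ⇒ ⊢ a ⊕ c ≲ b ⊕ d)
      (h e p) (sumOver-mono h ps)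

  jobs : List Entry → List Job
  jobs = map job

  at : (E : List Entry) → Fin (length (jobs E)) → Entry
  at (e ∷ E) zero    = e
  at (e ∷ E) (suc q) = at E q

  lookup-jobs : ∀ E q → lookup (jobs E) q ≡ job (at E q)
  lookup-jobs (e ∷ E) zero    = refl
  lookup-jobs (e ∷ E) (suc q) = lookup-jobs E q

  at-All : ∀ {P : Entry → Set} {E} → All P E → ∀ q → P (at E q)
  at-All (p ∷ _)  zero    = p
  at-All (_ ∷ ps) (suc q) = at-All ps q

  at-AllPairs : ∀ {R : Entry → Entry → Set} → (∀ {a b} → R a b → R b a) → ∀ {E} → AllPairs R E →
                ∀ q q′ → q ≢ q′ → R (at E q) (at E q′)
  at-AllPairs s (r ∷ rs) zero    zero     q≢q′ = contradiction refl q≢q′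
  at-AllPairs s (r ∷ rs) zero    (suc q′) q≢q′ = at-All r q′
  at-AllPairs s (r ∷ rs) (suc q) zero     q≢q′ = s (at-All r q)
  at-AllPairs s (r ∷ rs) (suc q) (suc q′) q≢q′ = at-AllPairs s rs q q′ (q≢q′ ∘ cong suc)

  sum-at : ∀ (f : Entry → Carrier) E → sum (λ q → f (at E q)) ≡ sumOver f E
  sum-at f []      = refl
  sum-at f (e ∷ E) = cong (f e +_) (sum-at f E)

  size≡sumOver : ∀ E → fromℕ (length (jobs E)) ≡ sumOver (λ _ → 1#) E
  size≡sumOver []      = refl
  size≡sumOver (e ∷ E) = cong (1# +_) (size≡sumOver E)

  left : ∀ E {E′} → Fin (length (jobs E)) → Fin (length (jobs (E ++ E′)))
  left (e ∷ E) zero    = zero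
  left (e ∷ E) (suc q) = suc (left E q)

  right : ∀ E {E′} → Fin (length (jobs E′)) → Fin (length (jobs (E ++ E′)))
  right []      q = q
  right (e ∷ E) q = suc (right E q)

  data SplitView (E E′ : List Entry) : Fin (length (jobs (E ++ E′))) → Set where
    old : ∀ q → SplitView E E′ (left E q)
    new : ∀ q → SplitView E E′ (right E q)

  splitView : ∀ E {E′} q → SplitView E E′ q
  splitView []      q       = new q
  splitView (e ∷ E) zero    = old zero
  splitView (e ∷ E) (suc q) with splitView E q
  ... | old q′ = old (suc q′)
  ... | new q′ = new q′

  lookup-left : ∀ E {E′} q → lookup (jobs (E ++ E′)) (left E q) ≡ lookup (jobs E) q
  lookup-left (e ∷ E) zero    = refl
  lookup-left (e ∷ E) (suc q) = lookup-left E q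

  lookup-right : ∀ E {E′} q → lookup (jobs (E ++ E′)) (right E q) ≡ lookup (jobs E′) q
  lookup-right []      q = refl
  lookup-right (e ∷ E) q = lookup-right E q

  sum-split : ∀ E {E′} (f : Fin (length (jobs (E ++ E′))) → Carrier) →
              sum f ≡ sum (f ∘ left E) + sum (f ∘ right E)
  sum-split []      f = ring (sum f ∷ []) (λ a → a , ∙0 ⊕ a)
  sum-split (e ∷ E) f = trans (cong (f zero +_) (sum-split E (f ∘ suc)))
    (ring (f zero ∷ sum (f ∘ suc ∘ left E) ∷ sum (f ∘ suc ∘ right E) ∷ []) (λ a b c → a ⊕ (b ⊕ c) ,
      a ⊕ b ⊕ c))

  Grows : Job → Job → Set
  Grows j j′ = Job.release j′ ≡ Job.release j × Job.predicted j′ ≡ Job.predicted j ×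
      Job.processing j ≤ Job.processing j′

  Grows-refl : ∀ {j} → Grows j j
  Grows-refl = refl , refl , ≤-refl

  data Extends (T : Carrier) : List Entry → List Entry → Set where
    late : ∀ {E} → All (λ e → T ≤ release e) E → Extends T [] E
    _∷_  : ∀ {e e′ E E′} → Grows (job e) (job e′) → Extends T E E′ → Extends T (e ∷ E) (e′ ∷ E′)

  module _ {T : Carrier} where
    embed : ∀ {E E′} → Extends T E E′ → Fin (length (jobs E)) → Fin (length (jobs E′))
    embed (_ ∷ x) zero    = zero
    embed (_ ∷ x) (suc q) = suc (embed x q)

    toℕ-embed : ∀ {E E′} (x : Extends T E E′) q → toℕ (embed x q) ≡ toℕ q
    toℕ-embed (_ ∷ x) zero    = refl
    toℕ-embed (_ ∷ x) (suc q) = cong suc (toℕ-embed x q)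

    embed-grows : ∀ {E E′} (x : Extends T E E′) q → Grows (lookup (jobs E) q)
        (lookup (jobs E′) (embed x q))
    embed-grows (g ∷ x) zero    = g
    embed-grows (g ∷ x) (suc q) = embed-grows x q

    embed-onto : ∀ {E E′} (x : Extends T E E′) q′ →
                 (∃[ q ] embed x q ≡ q′) ⊎ T ≤ Job.release (lookup (jobs E′) q′)
    embed-onto {E′ = E′} (late h) q′ = inj₂ (subst (λ j → T ≤ Job.release j) (sym (lookup-jobs E′ q′))
        (at-All h q′))
    embed-onto (_ ∷ x) zero     = inj₁ (zero , refl)
    embed-onto (_ ∷ x) (suc q′) = Sum.map₁ (λ (q , eq) → suc q , cong suc eq) (embed-onto x q′)

    extends-++ : ∀ E {E′} → All (λ e → T ≤ release e) E′ → Extends T E (E ++ E′)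
    extends-++ []      h = late h
    extends-++ (e ∷ E) h = Grows-refl {job e} ∷ extends-++ E h

    embed-++ : ∀ E {E′} (h : All (λ e → T ≤ release e) E′) q → embed (extends-++ E h) q ≡ left E q
    embed-++ (e ∷ E) h zero    = refl
    embed-++ (e ∷ E) h (suc q) = cong suc (embed-++ E h q)

    extends-append : ∀ E {E′ E″} → Extends T E′ E″ → Extends T (E ++ E′) (E ++ E″)
    extends-append []      x = x
    extends-append (e ∷ E) x = Grows-refl {job e} ∷ extends-append E x

    embed-appendˡ : ∀ E {E′ E″} (x : Extends T E′ E″) q → embed (extends-append E x) (left E q) ≡
        left E q
    embed-appendˡ (e ∷ E) x zero    = refl
    embed-appendˡ (e ∷ E) x (suc q) = cong suc (embed-appendˡ E x q)

    embed-appendʳ : ∀ E {E′ E″} (x : Extends T E′ E″) q → embed (extends-append E x) (right E q) ≡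
        right E (embed x q)
    embed-appendʳ []      x q = refl
    embed-appendʳ (e ∷ E) x q = cong suc (embed-appendʳ E x q)

  Ordered : List Entry → Set
  Ordered = AllPairs (λ e e′ → release e ≤ release e′)

  input : (E : List Entry) → Ordered E → Input
  input E ordered = record { jobs = jobs E ; sorted = AllPairs.map⁺ ordered }

  same-work : (ALG : OnlineAlgorithm) → let open OnlineAlgorithm ALG in
    ∀ {T E E′} (o : Ordered E) (o′ : Ordered E′) (x : Extends T E E′) →
    (∀ q → [ T ] ≤⁺ Schedule.completion (run (input E o)) q) →
    ∀ q {t} → 0# ≤ t → t ≤ T →
    Schedule.work (run (input E′ o′)) (embed x q) t ≡ Schedule.work (run (input E o)) q t
  same-work ALG {T} o o′ x = Indistinguishable.same-work ALG (input _ o) (input _ o′) T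
    (embed x) (toℕ-embed x) (proj₁ ∘ embed-grows x) (proj₁ ∘ proj₂ ∘ embed-grows x)
    (proj₂ ∘ proj₂ ∘ embed-grows x) (embed-onto x)

  Fits : Carrier → Carrier → Entry → Set
  Fits T L (entry j (fixed σ))    = Job.release j ≤ σ × σ + Job.processing j ≤ T
  Fits T L (entry j (deferred o)) = 0# ≤ o × o + Job.processing j ≤ L

  Compatible : Entry → Entry → Set
  Compatible (entry j (fixed σ))    (entry j′ (fixed σ′))    = Separate σ (σ + Job.processing j) σ′
      (σ′ + Job.processing j′)
  Compatible (entry j (deferred o)) (entry j′ (deferred o′)) = Separate o (o + Job.processing j) o′
      (o′ + Job.processing j′)
  Compatible _                      _                        = ⊤

  Compatible-sym : ∀ {e e′} → Compatible e e′ → Compatible e′ e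
  Compatible-sym {entry _ (fixed _)}    {entry _ (fixed _)}    = Sum.swap
  Compatible-sym {entry _ (fixed _)}    {entry _ (deferred _)} = λ _ → tt
  Compatible-sym {entry _ (deferred _)} {entry _ (fixed _)}    = λ _ → tt
  Compatible-sym {entry _ (deferred _)} {entry _ (deferred _)} = Sum.swap

  Fits-mono : ∀ {T T′ L L′} → T ≤ T′ → L ≤ L′ → ∀ {e} → Fits T L e → Fits T′ L′ e
  Fits-mono T≤ L≤ {entry _ (fixed _)}    (r≤σ , f) = r≤σ , ≤-trans f T≤
  Fits-mono T≤ L≤ {entry _ (deferred _)} (0≤o , f) = 0≤o , ≤-trans f L≤

  startAfter : Carrier → Entry → Carrier
  startAfter X (entry _ (fixed σ))    = σ
  startAfter X (entry _ (deferred o)) = X + o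

  flowAfter : Carrier → Entry → Carrier
  flowAfter X e = startAfter X e + processing e - release e

  module _ {X L : Carrier} where
    released-before-start : ∀ {e} → Fits X L e → release e ≤ X → release e ≤ startAfter X e
    released-before-start {entry _ (fixed _)}    (r≤σ , _) _   = r≤σ
    released-before-start {entry j (deferred o)} (0≤o , _) r≤X = lin (Job.release j ∷ X ∷ o ∷ [])
      (λ a X o → a ≲ X ⇒ ∙0 ≲ o ⇒ ⊢ a ≲ X ⊕ o) r≤X 0≤o

    shift-separate : ∀ {o p o′ p′} → Separate o (o + p) o′ (o′ + p′) → Separate (X + o) (X + o + p)
        (X + o′) (X + o′ + p′)
    shift-separate {o} {p} {o′} {p′} = Sum.map
      (λ h → (lin (o ∷ p ∷ o′ ∷ X ∷ []) (λ o p o′ X → o ⊕ p ≲ o′ ⇒ ⊢ X ⊕ o ⊕ p ≲ X ⊕ o′)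
        h)) (λ h → (lin (o′ ∷ p′ ∷ o ∷ X ∷ []) (λ o′ p′ o X → o′ ⊕ p′ ≲ o ⇒ ⊢ X ⊕ o′ ⊕ p′ ≲ X ⊕ o)
        h))

    separate-starts : ∀ {e e′} → Fits X L e → Fits X L e′ → Compatible e e′ →
      Separate (startAfter X e) (startAfter X e + processing e) (startAfter X e′)
          (startAfter X e′ + processing e′)
    separate-starts {entry _ (fixed _)} {entry _ (fixed _)} _ _ c = c
    separate-starts {entry _ (deferred _)} {entry _ (deferred _)} _ _ c = shift-separate c
    separate-starts {entry j (fixed σ)} {entry _ (deferred o)} (_ , f) (0≤o , _) _ =
      inj₁ (lin (σ ∷ Job.processing j ∷ X ∷ o ∷ []) (λ σ a X o → σ ⊕ a ≲ X ⇒ ∙0 ≲ o ⇒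
        ⊢ σ ⊕ a ≲ X ⊕ o) f 0≤o)
    separate-starts {entry _ (deferred o)} {entry j (fixed σ)} (0≤o , _) (_ , f) _ =
      inj₂ (lin (σ ∷ Job.processing j ∷ X ∷ o ∷ []) (λ σ a X o → σ ⊕ a ≲ X ⇒ ∙0 ≲ o ⇒
        ⊢ σ ⊕ a ≲ X ⊕ o) f 0≤o)

    offline : ∀ {E} (o : Ordered E) → All (Fits X L) E → All (λ e → release e ≤ X) E →
        AllPairs Compatible E →
              ∃[ S ] Schedule.cost {input E o} S ≡ [ sumOver (flowAfter X) E ]
    offline {E} o fits early compatible = schedule ,
      trans schedule-cost (cong [_] (trans (sum-cong-≗
          (λ q → cong (λ j → startAfter X (at E q) + Job.processing j - Job.release j)
              (lookup-jobs E q)))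
        (sum-at (flowAfter X) E)))
      where
      open NonPreemptive (input E o) (startAfter X ∘ at E)
        (λ q → subst (λ j → Job.release j ≤ startAfter X (at E q)) (sym (lookup-jobs E q))
          (released-before-start (at-All fits q) (at-All early q)))
        (λ q q′ q≢q′ → subst₂ (λ j j′ → Separate (startAfter X (at E q))
            (startAfter X (at E q) + Job.processing j) (startAfter X (at E q′))
                (startAfter X (at E q′) + Job.processing j′))
          (sym (lookup-jobs E q)) (sym (lookup-jobs E q′))
          (separate-starts (at-All fits q) (at-All fits q′)
              (at-AllPairs (λ {e} {e′} → Compatible-sym {e} {e′}) compatible q q′ q≢q′)))

module Adversary (ℝ : CompleteOrderedField) where
  open Entries ℝ public
  open Entry public

  bySlot : Carrier → Carrier → Entry → Carrier
  bySlot x y (entry _ (fixed _))    = x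
  bySlot x y (entry _ (deferred _)) = y

  RobustJob : Carrier → Job → Set
  RobustJob μ j = Job.predicted j ≤ Job.processing j × Job.processing j < μ * Job.predicted j

  mkJob : ∀ {r p p̃} → 0# ≤ r → 0# < p → 0# < p̃ → Job
  mkJob {r} {p} {p̃} 0≤r 0<p 0<p̃ = record
    { release = r ; processing = p ; predicted = p̃
    ; release≥0 = 0≤r ; processing>0 = 0<p ; predicted>0 = 0<p̃ }

  AtMost : Carrier → Entry → Set
  AtMost T e = release e ≤ T

  ordered-++ : ∀ {T E E′} → Ordered E → Ordered E′ → All (AtMost T) E → All (λ e → T ≤ release e) E′ →
      Ordered (E ++ E′)
  ordered-++ o o′ early h = AllPairs.++⁺ o o′ (All.map (λ r≤T → All.map (≤-trans r≤T) h) early)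

  module TwoCopies (E : List Entry) (j : Job) {σ σ′ : Slot} {o : Ordered
      (E ++ entry j σ ∷ entry j σ′ ∷ [])}
    (S : Schedule (input (E ++ entry j σ ∷ entry j σ′ ∷ []) o)) where
    open Job j using () renaming (release to T; processing to s; release≥0 to 0≤T; processing>0 to 0<s)
    open Schedule S
    open ScheduleProperties S
    open ScheduleCosts S

    position : Fin 2 → Fin (length (jobs (E ++ entry j σ ∷ entry j σ′ ∷ [])))
    position = right E

    new-job : ∀ i → lookup (jobs (E ++ entry j σ ∷ entry j σ′ ∷ [])) (position i) ≡ j
    new-job zero       = lookup-right E zero
    new-job (suc zero) = lookup-right E (suc zero)

    done : ∀ i → FirstReaches s (work (position i)) (completion (position i))
    done i = subst (λ x → FirstReaches (Job.processing x) (work (position i)) (completion (position i)))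
      (new-job i) (first-done (position i))

    work-at-T : ∀ i → work (position i) T ≡ 0#
    work-at-T i = work-unreleased (position i) 0≤T (≡⇒≤ (sym (cong Job.release (new-job i))))

    firstCompletion : ∃[ t ] (t ≤ T + s + s × (∀ i → [ t ] ≤⁺ completion (position i)) ×
            (t ≡ T + s + s ⊎ ∃[ i ] completion (position i) ≡ [ t ]))
    firstCompletion = earliest (completion ∘ position) (T + s + s)

    module _ {t} (t≤completion : ∀ i → [ t ] ≤⁺ completion (position i))
             (t-cases : t ≡ T + s + s ⊎ ∃[ i ] completion (position i) ≡ [ t ]) where
      private
        finished-at-t : ∀ {i} → completion (position i) ≡ [ t ] → FirstReaches s
            (work (position i)) [ t ]
        finished-at-t {i} c≡t = subst (FirstReaches s (work (position i))) c≡t (done i)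

      t-cases′ : t ≡ T + s + s ⊎ ∃[ i ] work (position i) t ≡ s
      t-cases′ = Sum.map₂ (λ (i , c≡t) → i , proj₁ (proj₂ (finished-at-t c≡t))) t-cases

      T≤t : T ≤ t
      T≤t = [
          (λ t≡ → (lin (T ∷ s ∷ t ∷ []) (λ T s t → T ⊕ s ⊕ s ≲ t ⇒ ∙0 ≺ s ⇒ ∙0 ≺ s ⇒ ⊢ T ≲ t)
            (≡⇒≤ (sym t≡)) 0<s 0<s))
        , (λ (i , c≡t) → subst (λ x → Job.release x ≤ t) (new-job i)
            (worked⇒released (position i) (proj₁ (finished-at-t c≡t))
              (subst (0# <_) (sym (proj₁ (proj₂ (finished-at-t c≡t)))) 0<s)))
        ]′ t-cases

      private
        w : Fin 2 → Carrier
        w i = work (position i) t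

      0≤t : 0# ≤ t
      0≤t = ≤-trans 0≤T T≤t

      w≤s : ∀ i → w i ≤ s
      w≤s i = FirstReaches-at (done i) (t≤completion i) 0≤t

      w≥0 : ∀ i → 0# ≤ w i
      w≥0 i = work≥0 (position i) 0≤t

      w+w≤ : w zero + w (suc zero) ≤ t - T
      w+w≤ = lin (sum (λ q → work q t - work q T) ∷ t ∷ T ∷ sum old-gain ∷ w zero ∷
        work (position zero) T ∷ w (suc zero) ∷ work (position (suc zero)) T ∷ [])
        (λ a t T b c d e f → a ≲ t ⊖′ T ⇒ b ⊕ (c ⊖′ d ⊕ (e ⊖′ f ⊕ ∙0)) ≲ a ⇒ d ≲ ∙0 ⇒ f ≲ ∙0 ⇒
        ∙0 ≲ b ⇒ ⊢ c ⊕ e ≲ t ⊖′ T) (work-gained 0≤T T≤t)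
        (≡⇒≤ (sym (sum-split E (λ q → work q t - work q T)))) (≡⇒≤ (work-at-T zero))
        (≡⇒≤ (work-at-T (suc zero))) (sum-nonneg old-gain≥0)
        where
        old-gain : Fin (length (jobs E)) → Carrier
        old-gain q = work (left E q) t - work (left E q) T

        old-gain≥0 : ∀ q → 0# ≤ old-gain q
        old-gain≥0 q = lin (work (left E q) T ∷ work (left E q) t ∷ []) (λ a b → a ≲ b ⇒
          ⊢ ∙0 ≲ b ⊖′ a) (work-mono (left E q) 0≤T T≤t)

      one-fits : ∀ {ε} (extra : Fin 2 → Carrier) → ε ≤ s → (∀ i → extra i ≤ ε) → (∀ i → extra i ≤ w i) →
                 s + extra zero ≤ t - T ⊎ s + extra (suc zero) ≤ t - T
      one-fits {ε} extra ε≤s extra≤ε extra≤w with t-cases′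
      ... | inj₁ t≡ = inj₁ (lin (T ∷ s ∷ t ∷ extra zero ∷ ε ∷ []) (λ T s t a ε → T ⊕ s ⊕ s ≲ t ⇒
        a ≲ ε ⇒ ε ≲ s ⇒ ⊢ s ⊕ a ≲ t ⊖′ T) (≡⇒≤ (sym t≡)) (extra≤ε zero) ε≤s)
      ... | inj₂ (zero , w≡s) = inj₂ (lin (s ∷ w zero ∷ extra (suc zero) ∷ w (suc zero) ∷ t ∷
        T ∷ []) (λ s a b c t T → s ≲ a ⇒ b ≲ c ⇒ a ⊕ c ≲ t ⊖′ T ⇒ ⊢ s ⊕ b ≲ t ⊖′ T) (≡⇒≤ (sym w≡s))
        (extra≤w (suc zero)) w+w≤)
      ... | inj₂ (suc zero , w≡s) = inj₁ (lin (s ∷ w (suc zero) ∷ extra zero ∷ w zero ∷ t ∷ T ∷ [])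
        (λ s a b c t T → s ≲ a ⇒ b ≲ c ⇒ c ⊕ a ≲ t ⊖′ T ⇒ ⊢ s ⊕ b ≲ t ⊖′ T) (≡⇒≤ (sym w≡s))
        (extra≤w zero) w+w≤)

  module _ (ALG : OnlineAlgorithm) (μ : Carrier) (1<μ : 1# < μ) where
    open OnlineAlgorithm ALG

    workOf : ∀ {E} (o : Ordered E) → Fin (length (jobs E)) → Carrier → Carrier
    workOf o = Schedule.work (run (input _ o))

    scales : ∀ {ρ} → 0# < ρ → ∃[ s ] ∃[ ε ]
             (0# < s × s + s + s + s ≤ ρ × 0# < ε × ε ≤ s × s + ε < μ * s)
    scales {ρ} 0<ρ with minimum (half (half ρ)) (μ * half (half ρ) - half (half ρ))
    ... | m , m≤s , m≤slack , m∈ = half (half ρ) , half m , 0<s ,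
        (lin (half (half ρ) ∷ half ρ ∷ ρ ∷ []) (λ a b ρ → a ⊕ a ≲ b ⇒ a ⊕ a ≲ b ⇒ b ⊕ b ≲ ρ ⇒
          ⊢ a ⊕ a ⊕ a ⊕ a ≲ ρ) (≡⇒≤ (half+half (half ρ))) (≡⇒≤ (half+half (half ρ)))
          (≡⇒≤ (half+half ρ))) ,
        half>0 0<m ,
        (lin (half m ∷ m ∷ half (half ρ) ∷ []) (λ a m b → a ⊕ a ≲ m ⇒ ∙0 ≺ a ⇒ m ≲ b ⇒ ⊢ a ≲ b)
          (≡⇒≤ (half+half m)) (half>0 0<m) m≤s) ,
        (lin (half m ∷ m ∷ μ ∷ half (half ρ) ∷ []) (λ a m μ b → a ⊕ a ≲ m ⇒ ∙0 ≺ a ⇒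
          m ≲ μ ⊗ b ⊖′ b ⇒ ⊢ b ⊕ a ≺ μ ⊗ b) (≡⇒≤ (half+half m)) (half>0 0<m) m≤slack)
      where
      0<s : 0# < half (half ρ)
      0<s = half>0 (half>0 0<ρ)

      0<m : 0# < m
      0<m = [ (λ m≡ → subst (0# <_) (sym m≡) 0<s)
            , (λ m≡ → subst (0# <_) (sym m≡)
                (lin (μ ∷ half (half ρ) ∷ []) (λ μ a → ∙0 ≺ (μ ⊖′ ∙1) ⊗ a ⇒ ⊢ ∙0 ≺ μ ⊗ a ⊖′ a)
                  (*-pos (lin (μ ∷ []) (λ μ → ∙1 ≺ μ ⇒ ⊢ ∙0 ≺ μ ⊖′ ∙1) 1<μ) 0<s))) ]′ m∈

    -- At time T the algorithm still has to process at least ρ of each of the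
    -- 2K jobs released so far, while an offline schedule has completed K of
    -- them and defers the others, which take time L.
    record Stage (K : ℕ) : Set where
      field
        entries    : List Entry
        T L ρ      : Carrier
        0≤T        : 0# ≤ T
        0≤L        : 0# ≤ L
        0<ρ        : 0# < ρ
        ordered    : Ordered entries
        early      : All (AtMost T) entries
        robust     : All (RobustJob μ ∘ job) entries
        fits       : All (Fits T L) entries
        compatible : AllPairs Compatible entries
        balanced   : ∀ x y → sumOver (bySlot x y) entries ≡ fromℕ K * (x + y)
        remaining  : ∀ q → workOf ordered q T + ρ ≤ Job.processing (lookup (jobs entries) q)

    initial : Stage 0
    initial = record
      { entries = [] ; T = 0# ; L = 0# ; ρ = 1# ; 0≤T = ≤-refl ; 0≤L = ≤-refl ; 0<ρ = 0<1
      ; ordered = [] ; early = [] ; robust = [] ; fits = [] ; compatible = []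
      ; balanced = λ x y → (ring (x ∷ y ∷ []) (λ x y → ∙0 , ∙0 ⊗ (x ⊕ y))) ; remaining = λ () }

    module _ {K} (stage : Stage K) where
      open Stage stage

      unfinished-at-T : ∀ q → [ T ] ≤⁺ Schedule.completion (run (input entries ordered)) q
      unfinished-at-T q = ScheduleProperties.unfinished (run (input entries ordered)) q 0≤T
        (lin (workOf ordered q T ∷ ρ ∷ Job.processing (lookup (jobs entries) q) ∷ [])
          (λ a ρ b → a ⊕ ρ ≲ b ⇒ ∙0 ≺ ρ ⇒ ⊢ a ≺ b) (remaining q) 0<ρ)

      same-work-left : ∀ {E′} (o′ : Ordered (entries ++ E′)) → All (λ e → T ≤ release e) E′ →
                       ∀ q → workOf o′ (left entries q) T ≡ workOf ordered q T
      same-work-left o′ h q = subst (λ q′ → workOf o′ q′ T ≡ workOf ordered q T) (embed-++ entries h q)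
        (same-work ALG ordered o′ (extends-++ entries h) unfinished-at-T q 0≤T ≤-refl)

      -- In the reference run both new jobs have the predicted processing time s.
      module _ {s ε} (0<s : 0# < s) (4s≤ρ : s + s + s + s ≤ ρ) (0<ε : 0# < ε) (ε≤s : ε ≤ s)
          (s+ε<μs : s + ε < μ * s) where
        private
          newJob : ∀ {p} → 0# < p → Job
          newJob 0<p = mkJob {T} {_} {s} 0≤T 0<p 0<s

          ordered⁺ : ∀ {p p′} (0<p : 0# < p) (0<p′ : 0# < p′) {σ σ′} →
                     Ordered (entries ++ entry (newJob 0<p) σ ∷ entry (newJob 0<p′) σ′ ∷ [])
          ordered⁺ _ _ = ordered-++ ordered ((≤-refl ∷ []) ∷ [] ∷ []) early (≤-refl ∷ ≤-refl ∷ [])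

          referencePair : List Entry
          referencePair = entry (newJob 0<s) (fixed T) ∷ entry (newJob 0<s) (fixed T) ∷ []

          referenceOrdered : Ordered (entries ++ referencePair)
          referenceOrdered = ordered⁺ 0<s 0<s

          reference : Schedule (input (entries ++ referencePair) referenceOrdered)
          reference = run (input (entries ++ referencePair) referenceOrdered)

          module Reference = TwoCopies entries (newJob 0<s) reference
          open Schedule reference
          open ScheduleProperties reference
          open ScheduleCosts reference
          open Reference using (position)

          module Next {t} (t≤T+2s : t ≤ T + s + s)
              (t≤completion : ∀ i → [ t ] ≤⁺ completion (position i))
                      (t-cases : t ≡ T + s + s ⊎ ∃[ i ] completion (position i) ≡ [ t ]) where
            T≤t : T ≤ t
            T≤t = Reference.T≤t t≤completion t-cases

            0≤t : 0# ≤ t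
            0≤t = ≤-trans 0≤T T≤t

            w : Fin 2 → Carrier
            w i = work (position i) t

            old-remaining : ∀ q → work (left entries q) t + ε ≤ Job.processing (lookup (jobs entries) q)
            old-remaining q =
              lin (workOf ordered q T ∷ ρ ∷ Job.processing (lookup (jobs entries) q) ∷
                work (left entries q) T ∷ work (left entries q) t ∷ t ∷ T ∷ s ∷ ε ∷ [])
                (λ a ρ b c d t T s ε → a ⊕ ρ ≲ b ⇒ c ≲ a ⇒ d ⊖′ c ≲ t ⊖′ T ⇒ t ≲ T ⊕ s ⊕ s ⇒
                s ⊕ s ⊕ s ⊕ s ≲ ρ ⇒ ε ≲ s ⇒ ∙0 ≺ s ⇒ ⊢ d ⊕ ε ≲ b) (remaining q)
                (≡⇒≤ (same-work-left referenceOrdered (≤-refl ∷ ≤-refl ∷ []) q))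
                (work-lipschitz (left entries q) 0≤T T≤t) t≤T+2s 4s≤ρ ε≤s 0<s

            unfinished-at-t : ∀ q → [ t ] ≤⁺ completion q
            unfinished-at-t q = unfinished-part (splitView entries q)
              where
              unfinished-part : ∀ {q} → SplitView entries referencePair q → [ t ] ≤⁺ completion q
              unfinished-part (new zero)       = t≤completion zero
              unfinished-part (new (suc zero)) = t≤completion (suc zero)
              unfinished-part (old q′) = unfinished (left entries q′) 0≤t
                (subst (λ j → work (left entries q′) t < Job.processing j)
                    (sym (lookup-left entries q′))
                (lin (work (left entries q′) t ∷ ε ∷ Job.processing (lookup (jobs entries) q′) ∷ [])
                  (λ a ε b → a ⊕ ε ≲ b ⇒ ∙0 ≺ ε ⇒ ⊢ a ≺ b) (old-remaining q′) 0<ε))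

            -- The processing times s + min (ε , w) leave at least ε of each new job
            -- at time t, although one of the two jobs fits into [ T , t ].
            extra : Fin 2 → Carrier
            extra i = proj₁ (minimum ε (w i))

            extra≤ε : ∀ i → extra i ≤ ε
            extra≤ε i = proj₁ (proj₂ (minimum ε (w i)))

            extra≤w : ∀ i → extra i ≤ w i
            extra≤w i = proj₁ (proj₂ (proj₂ (minimum ε (w i))))

            extra-cases : ∀ i → extra i ≡ ε ⊎ extra i ≡ w i
            extra-cases i = proj₂ (proj₂ (proj₂ (minimum ε (w i))))

            extra≥0 : ∀ i → 0# ≤ extra i
            extra≥0 i = [ (λ ≡ε → subst (0# ≤_) (sym ≡ε) (<⇒≤ 0<ε))
                        , (λ ≡w → subst (0# ≤_) (sym ≡w) (Reference.w≥0 t≤completion t-cases i)) ]′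
                            (extra-cases i)

            p : Fin 2 → Carrier
            p i = s + extra i

            s≤p : ∀ i → s ≤ p i
            s≤p i = lin (extra i ∷ s ∷ []) (λ a s → ∙0 ≲ a ⇒ ⊢ s ≲ s ⊕ a) (extra≥0 i)

            0<p : ∀ i → 0# < p i
            0<p i = <-≤-trans 0<s (s≤p i)

            w+ε≤p : ∀ i → w i + ε ≤ p i
            w+ε≤p i = [
                (λ ≡ε → (lin (ε ∷ extra i ∷ w i ∷ s ∷ []) (λ ε a b s → ε ≲ a ⇒ b ≲ s ⇒
                  ⊢ b ⊕ ε ≲ s ⊕ a) (≡⇒≤ (sym ≡ε)) (Reference.w≤s t≤completion t-cases i)))
              , (λ ≡w → (lin (w i ∷ extra i ∷ ε ∷ s ∷ []) (λ a b ε s → a ≲ b ⇒ ε ≲ s ⇒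
                ⊢ a ⊕ ε ≲ s ⊕ b) (≡⇒≤ (sym ≡w)) ε≤s))
              ]′ (extra-cases i)

            realJob : Fin 2 → Job
            realJob i = newJob (0<p i)

            robust-new : ∀ i → RobustJob μ (realJob i)
            robust-new i = s≤p i , (lin (extra i ∷ ε ∷ s ∷ μ ∷ []) (λ a ε s μ → a ≲ ε ⇒
              s ⊕ ε ≺ μ ⊗ s ⇒ ⊢ s ⊕ a ≺ μ ⊗ s) (extra≤ε i) s+ε<μs)

            grows : ∀ i → Grows (newJob 0<s) (realJob i)
            grows i = refl , refl , s≤p i

            module _ (slot₀ slot₁ : Slot) where
              newPair : List Entry
              newPair = entry (realJob zero) slot₀ ∷ entry (realJob (suc zero)) slot₁ ∷ []

              new-ordered : Ordered (entries ++ newPair)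
              new-ordered = ordered⁺ (0<p zero) (0<p (suc zero))

              extends : Extends t referencePair newPair
              extends = grows zero ∷ grows (suc zero) ∷ late []

              remaining-old : ∀ q → workOf new-ordered (left entries q) t + ε ≤ Job.processing
                  (lookup (jobs (entries ++ newPair)) (left entries q))
              remaining-old q = subst₂ (λ x j → x + ε ≤ Job.processing j)
                (sym (subst (λ q′ → workOf new-ordered q′ t ≡ work (left entries q) t)
                    (embed-appendˡ entries extends q)
                  (same-work ALG referenceOrdered new-ordered
                      (extends-append entries extends) unfinished-at-t (left entries q) 0≤t ≤-refl)))
                (sym (lookup-left entries q))
                (old-remaining q)

              remaining-new : ∀ i →
                workOf new-ordered (right entries (embed extends i)) t + ε ≤ Job.processing
                    (lookup (jobs newPair) (embed extends i)) →
                workOf new-ordered (right entries (embed extends i)) t + ε ≤ Job.processing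
                    (lookup (jobs (entries ++ newPair)) (right entries (embed extends i)))
              remaining-new i = subst (λ j → workOf new-ordered
                  (right entries (embed extends i)) t + ε ≤ Job.processing j)
                      (sym (lookup-right entries (embed extends i)))

              work-new : ∀ i → workOf new-ordered (right entries (embed extends i)) t ≡ w i
              work-new i = subst (λ q′ → workOf new-ordered q′ t ≡ w i)
                  (embed-appendʳ entries extends i)
                (same-work ALG referenceOrdered new-ordered
                    (extends-append entries extends) unfinished-at-t (position i) 0≤t ≤-refl)

              new-remaining : ∀ q → workOf new-ordered q t + ε ≤ Job.processing
                  (lookup (jobs (entries ++ newPair)) q)
              new-remaining q = remaining-part (splitView entries q)
                where
                remaining-part : ∀ {q} → SplitView entries newPair q →
                                 workOf new-ordered q t + ε ≤ Job.processing
                                     (lookup (jobs (entries ++ newPair)) q)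
                remaining-part (old q′)         = remaining-old q′
                remaining-part (new zero)       = remaining-new zero
                    (subst (λ x → x + ε ≤ p zero) (sym (work-new zero)) (w+ε≤p zero))
                remaining-part (new (suc zero)) = remaining-new (suc zero)
                    (subst (λ x → x + ε ≤ p (suc zero)) (sym (work-new (suc zero))) (w+ε≤p (suc zero)))

              extended : ∀ {L′} → L ≤ L′ → All (Fits t L′) newPair → AllPairs Compatible newPair →
                         (∀ e → Fits T L e → All (Compatible e) newPair) →
                         (∀ x y → sumOver (bySlot x y) newPair ≡ x + y) → Stage (suc K)
              extended {L′} L≤L′ fits′ compatible′ compatible″ balanced′ = record
                { entries = entries ++ newPair ; T = t ; L = L′ ; ρ = ε
                ; 0≤T = 0≤t ; 0≤L = ≤-trans 0≤L L≤L′ ; 0<ρ = 0<ε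
                ; ordered = new-ordered
                ; early = All.++⁺ (All.map (λ r≤T → ≤-trans r≤T T≤t) early) (T≤t ∷ T≤t ∷ [])
                ; robust = All.++⁺ robust (robust-new zero ∷ robust-new (suc zero) ∷ [])
                ; fits = All.++⁺ (All.map (λ {e} → Fits-mono T≤t L≤L′ {e}) fits) fits′
                ; compatible = AllPairs.++⁺ compatible compatible′
                    (All.map (λ {e} → compatible″ e) fits)
                ; balanced = λ x y → trans (sumOver-++ (bySlot x y) entries)
                    (trans (cong₂ _+_ (balanced x y) (balanced′ x y)) (ring (fromℕ K ∷ x ∷ y ∷ [])
                      (λ a x y → a ⊗ (x ⊕ y) ⊕ (x ⊕ y) , (∙1 ⊕ a) ⊗ (x ⊕ y))))
                ; remaining = new-remaining
                }

            L≤L+p : ∀ i → L ≤ L + p i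
            L≤L+p i = lin (p i ∷ L ∷ []) (λ a L → ∙0 ≺ a ⇒ ⊢ L ≲ L ⊕ a) (0<p i)

            fits-fixed : ∀ i {L′} → p i ≤ t - T → Fits t L′ (entry (realJob i) (fixed T))
            fits-fixed i h = ≤-refl , (lin (p i ∷ t ∷ T ∷ []) (λ a t T → a ≲ t ⊖′ T ⇒ ⊢ T ⊕ a ≲ t)
              h)

            fits-deferred : ∀ i → Fits t (L + p i) (entry (realJob i) (deferred L))
            fits-deferred i = 0≤L , ≤-refl

            compatible-fixed : ∀ i e → Fits T L e → Compatible e (entry (realJob i) (fixed T))
            compatible-fixed i (entry _ (fixed _))    (_ , f) = inj₁ f
            compatible-fixed i (entry _ (deferred _)) _       = tt

            compatible-deferred : ∀ i e → Fits T L e → Compatible e (entry (realJob i) (deferred L))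
            compatible-deferred i (entry _ (fixed _))    _       = tt
            compatible-deferred i (entry _ (deferred _)) (_ , f) = inj₁ f

            next : Stage (suc K)
            next = [
                (λ h → extended (fixed T) (deferred L) (L≤L+p (suc zero))
                  (fits-fixed zero {L + p (suc zero)} h ∷ fits-deferred (suc zero) ∷ [])
                      ((tt ∷ []) ∷ [] ∷ [])
                  (λ e f → compatible-fixed zero e f ∷ compatible-deferred (suc zero) e f ∷ [])
                  (λ x y → (ring (x ∷ y ∷ []) (λ x y → x ⊕ (y ⊕ ∙0) , x ⊕ y))))
              , (λ h → extended (deferred L) (fixed T) (L≤L+p zero)
                  (fits-deferred zero ∷ fits-fixed (suc zero) {L + p zero} h ∷ []) ((tt ∷ []) ∷ [] ∷ [])
                  (λ e f → compatible-deferred zero e f ∷ compatible-fixed (suc zero) e f ∷ [])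
                  (λ x y → (ring (y ∷ x ∷ []) (λ y x → y ⊕ (x ⊕ ∙0) , x ⊕ y))))
              ]′ (Reference.one-fits t≤completion t-cases extra ε≤s extra≤ε extra≤w)

        nextStage′ : Stage (suc K)
        nextStage′ = let (t , t≤T+2s , t≤completion , t-cases) = Reference.firstCompletion in
          Next.next t≤T+2s t≤completion t-cases

      nextStage : Stage (suc K)
      nextStage = let (s , ε , 0<s , 4s≤ρ , 0<ε , ε≤s , s+ε<μs) = scales 0<ρ in
        nextStage′ 0<s 4s≤ρ 0<ε ε≤s s+ε<μs

    stages : ∀ K → Stage K
    stages zero    = initial
    stages (suc K) = nextStage (stages K)

module LowerBound (ℝ : CompleteOrderedField) where
  open Adversary ℝ public
  open Strict⁺ _<_ using ([_]; [_]<⊤⁺)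

  module Stream {δ : Carrier} (0<δ : 0# < δ) where
    later : ∀ {x} → 0# ≤ x → 0# ≤ x + δ
    later {x} 0≤x = lin (x ∷ δ ∷ []) (λ x δ → ∙0 ≲ x ⇒ ∙0 ≺ δ ⇒ ⊢ ∙0 ≲ x ⊕ δ) 0≤x 0<δ

    streamEntry : ∀ {x} → 0# ≤ x → Entry
    streamEntry {x} 0≤x = entry (mkJob 0≤x 0<δ 0<δ) (fixed x)

    stream : ℕ → ∀ {x} → 0# ≤ x → List Entry
    stream zero    0≤x = []
    stream (suc N) 0≤x = streamEntry 0≤x ∷ stream N (later 0≤x)

    record InStream (x y : Carrier) (e : Entry) : Set where
      constructor inStream
      field
        {σ}    : Carrier
        0≤σ    : 0# ≤ σ
        e≡     : e ≡ streamEntry 0≤σ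
        x≤σ    : x ≤ σ
        σ+δ≤y  : σ + δ ≤ y

    InStream-widen : ∀ {x x′ y y′} → x′ ≤ x → y ≤ y′ → ∀ {e} → InStream x y e → InStream x′ y′ e
    InStream-widen x′≤x y≤y′ (inStream 0≤σ e≡ x≤σ σ+δ≤y) = inStream 0≤σ e≡ (≤-trans x′≤x x≤σ)
        (≤-trans σ+δ≤y y≤y′)

    x≤x+δ : ∀ x → x ≤ x + δ
    x≤x+δ x = lin (δ ∷ x ∷ []) (λ δ x → ∙0 ≺ δ ⇒ ⊢ x ≲ x ⊕ δ) 0<δ

    in-stream : ∀ N {x} (0≤x : 0# ≤ x) → All (InStream x (x + fromℕ N * δ)) (stream N 0≤x)
    in-stream zero    0≤x = []
    in-stream (suc N) {x} 0≤x =
      inStream 0≤x refl ≤-refl (lin (fromℕ N ∷ δ ∷ x ∷ []) (λ a δ x → a ⊗ ∙0 ≲ a ⊗ δ ⇒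
        ⊢ x ⊕ δ ≲ x ⊕ (∙1 ⊕ a) ⊗ δ) (*-monoˡ-≤ (fromℕ≥0 N) (<⇒≤ 0<δ)))
      ∷ All.map (InStream-widen (x≤x+δ x) (≡⇒≤ (ring (x ∷ δ ∷ fromℕ N ∷ [])
        (λ x δ a → x ⊕ δ ⊕ a ⊗ δ , x ⊕ (∙1 ⊕ a) ⊗ δ)))) (in-stream N (later 0≤x))

    stream-ordered : ∀ N {x} (0≤x : 0# ≤ x) → Ordered (stream N 0≤x)
    stream-ordered zero    0≤x = []
    stream-ordered (suc N) {x} 0≤x =
      All.map (λ { (inStream _ refl x+δ≤σ _) → ≤-trans (x≤x+δ x) x+δ≤σ }) (in-stream N (later 0≤x))
      ∷ stream-ordered N (later 0≤x)

    stream-compatible : ∀ N {x} (0≤x : 0# ≤ x) → AllPairs Compatible (stream N 0≤x)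
    stream-compatible zero    0≤x = []
    stream-compatible (suc N) {x} 0≤x =
      All.map (λ { (inStream _ refl x+δ≤σ _) → inj₁ x+δ≤σ }) (in-stream N (later 0≤x))
      ∷ stream-compatible N (later 0≤x)

    stream-size : ∀ N {x} (0≤x : 0# ≤ x) → sumOver (λ _ → 1#) (stream N 0≤x) ≡ fromℕ N
    stream-size zero    0≤x = refl
    stream-size (suc N) 0≤x = cong (1# +_) (stream-size N (later 0≤x))

    stream-flow : ∀ X N {x} (0≤x : 0# ≤ x) → sumOver (flowAfter X) (stream N 0≤x) ≡ fromℕ N * δ
    stream-flow X zero    0≤x = ring (δ ∷ []) (λ δ → ∙0 , ∙0 ⊗ δ)
    stream-flow X (suc N) {x} 0≤x = trans (cong (x + δ - x +_) (stream-flow X N (later 0≤x)))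
      (ring (x ∷ δ ∷ fromℕ N ∷ []) (λ x δ a → x ⊕ δ ⊖′ x ⊕ a ⊗ δ , (∙1 ⊕ a) ⊗ δ))

    stream-offset : ∀ N {x} (0≤x : 0# ≤ x) → let n = fromℕ N in
                    sumOver (λ e → x - release e) (stream N 0≤x) + sumOver (λ e → x - release e)
                        (stream N 0≤x) ≡ n * δ - n * n * δ
    stream-offset zero    0≤x = ring (δ ∷ []) (λ δ → ∙0 ⊕ ∙0 , ∙0 ⊗ δ ⊖′ ∙0 ⊗ ∙0 ⊗ δ)
    stream-offset (suc N) {x} 0≤x = ≤-antisym
      (lin (A ∷ B ∷ fromℕ N ∷ δ ∷ x ∷ []) (λ A B a δ x → A ≲ B ⊖′ a ⊗ δ ⇒ A ≲ B ⊖′ a ⊗ δ ⇒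
        B ⊕ B ≲ a ⊗ δ ⊖′ a ⊗ a ⊗ δ ⇒
        ⊢ x ⊖′ x ⊕ A ⊕ (x ⊖′ x ⊕ A) ≲ (∙1 ⊕ a) ⊗ δ ⊖′ (∙1 ⊕ a) ⊗ (∙1 ⊕ a) ⊗ δ)
        (≡⇒≤ (shift N (later 0≤x))) (≡⇒≤ (shift N (later 0≤x))) (≡⇒≤ (stream-offset N (later 0≤x))))
      (lin (B ∷ fromℕ N ∷ δ ∷ A ∷ x ∷ []) (λ B a δ A x → B ⊖′ a ⊗ δ ≲ A ⇒ B ⊖′ a ⊗ δ ≲ A ⇒
        a ⊗ δ ⊖′ a ⊗ a ⊗ δ ≲ B ⊕ B ⇒
        ⊢ (∙1 ⊕ a) ⊗ δ ⊖′ (∙1 ⊕ a) ⊗ (∙1 ⊕ a) ⊗ δ ≲ x ⊖′ x ⊕ A ⊕ (x ⊖′ x ⊕ A))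
        (≡⇒≤ (sym (shift N (later 0≤x)))) (≡⇒≤ (sym (shift N (later 0≤x))))
        (≡⇒≤ (sym (stream-offset N (later 0≤x)))))
      where
      A B : Carrier
      A = sumOver (λ e → x - release e) (stream N (later 0≤x))
      B = sumOver (λ e → x + δ - release e) (stream N (later 0≤x))

      shift : ∀ N {y} (0≤y : 0# ≤ y) → sumOver (λ e → x - release e) (stream N 0≤y) ≡ sumOver
          (λ e → x + δ - release e) (stream N 0≤y) - fromℕ N * δ
      shift zero    0≤y = ring (δ ∷ []) (λ δ → ∙0 , ∙0 ⊖′ ∙0 ⊗ δ)
      shift (suc N) {y} 0≤y = trans (cong (x - y +_) (shift N (later 0≤y)))
        (ring (x ∷ y ∷ sumOver (λ e → x + δ - release e) (stream N (later 0≤y)) ∷ fromℕ N ∷ δ ∷ [])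
          (λ x y a b δ → x ⊖′ y ⊕ (a ⊖′ b ⊗ δ) , x ⊕ δ ⊖′ y ⊕ a ⊖′ (∙1 ⊕ b) ⊗ δ))

  module _ (ALG : OnlineAlgorithm) (μ : Carrier) (1<μ : 1# < μ) where
    module _ {K} (stage : Stage ALG μ 1<μ K) (N : ℕ) where
      open Stage stage renaming (ρ to δ; 0<ρ to 0<δ)
      open Stream 0<δ
      private
        k n : Carrier
        k = fromℕ K
        n = fromℕ N

        final : List Entry
        final = entries ++ stream N 0≤T

        end : Carrier
        end = T + n * δ

        in-final : All (InStream T end) (stream N 0≤T)
        in-final = in-stream N 0≤T

        stream-late : All (λ e → T ≤ release e) (stream N 0≤T)
        stream-late = All.map (λ { (inStream _ refl T≤σ _) → T≤σ }) in-final

        T≤end : T ≤ end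
        T≤end = lin (n ∷ δ ∷ T ∷ []) (λ n δ T → n ⊗ ∙0 ≲ n ⊗ δ ⇒ ⊢ T ≲ T ⊕ n ⊗ δ)
          (*-monoˡ-≤ (fromℕ≥0 N) (<⇒≤ 0<δ))

        final-ordered : Ordered final
        final-ordered = ordered-++ ordered (stream-ordered N 0≤T) early stream-late

        final-fits : All (Fits end L) final
        final-fits = All.++⁺ (All.map (λ {e} → Fits-mono T≤end ≤-refl {e}) fits)
          (All.map (λ { (inStream _ refl _ σ+δ≤end) → ≤-refl , σ+δ≤end }) in-final)

        final-early : All (AtMost end) final
        final-early = All.++⁺ (All.map (λ r≤T → ≤-trans r≤T T≤end) early)
          (All.map (λ { (inStream {σ} _ refl _ σ+δ≤end) → ≤-trans (x≤x+δ σ) σ+δ≤end }) in-final)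

        compatible-stream : ∀ e → Fits T L e → ∀ {e′} → InStream T end e′ → Compatible e e′
        compatible-stream (entry _ (fixed _))    (_ , f) (inStream _ refl T≤σ _) = inj₁ (≤-trans f T≤σ)
        compatible-stream (entry _ (deferred _)) _       (inStream _ refl _ _)   = tt

        final-compatible : AllPairs Compatible final
        final-compatible = AllPairs.++⁺ compatible (stream-compatible N 0≤T)
          (All.map (λ {e} f → All.map (compatible-stream e f) in-final) fits)

      finalInput : Input
      finalInput = input final final-ordered

      final-robust : Robust μ finalInput
      final-robust q = subst (RobustJob μ) (sym (lookup-jobs final q)) (at-All (All.++⁺ robust
        (All.map (λ { (inStream _ refl _ _) → ≤-refl , (lin (μ ∷ δ ∷ [])
          (λ μ δ → ∙0 ≺ (μ ⊖′ ∙1) ⊗ δ ⇒ ⊢ δ ≺ μ ⊗ δ) (*-pos (lin (μ ∷ []) (λ μ → ∙1 ≺ μ ⇒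
          ⊢ ∙0 ≺ μ ⊖′ ∙1) 1<μ) 0<δ)) }) in-final)) q)

      offlineBound : Carrier
      offlineBound = k * (T + (end + L)) + n * δ

      flow-bound : ∀ e → Fits T L e → flowAfter end e ≤ bySlot T (end + L) e
      flow-bound (entry j (fixed σ))    (_ , f) = lin (σ ∷ Job.processing j ∷ T ∷
        Job.release j ∷ []) (λ σ a T b → σ ⊕ a ≲ T ⇒ ∙0 ≲ b ⇒ ⊢ σ ⊕ a ⊖′ b ≲ T) f (Job.release≥0 j)
      flow-bound (entry j (deferred o)) (_ , f) = lin (o ∷ Job.processing j ∷ L ∷ Job.release j ∷
        end ∷ []) (λ o a L b end → o ⊕ a ≲ L ⇒ ∙0 ≲ b ⇒ ⊢ end ⊕ o ⊕ a ⊖′ b ≲ end ⊕ L) f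
        (Job.release≥0 j)

      offline-cost : sumOver (flowAfter end) final ≤ offlineBound
      offline-cost =
        lin (sumOver (flowAfter end) final ∷ sumOver (flowAfter end) entries ∷
          sumOver (flowAfter end) (stream N 0≤T) ∷ sumOver (bySlot T (end + L)) entries ∷ k ∷ T ∷
          end ∷ L ∷ n ∷ δ ∷ []) (λ a b c d k T end L n δ → a ≲ b ⊕ c ⇒ b ≲ d ⇒
          d ≲ k ⊗ (T ⊕ (end ⊕ L)) ⇒ c ≲ n ⊗ δ ⇒ ⊢ a ≲ k ⊗ (T ⊕ (end ⊕ L)) ⊕ n ⊗ δ)
          (≡⇒≤ (sumOver-++ (flowAfter end) entries)) (sumOver-mono flow-bound fits)
          (≡⇒≤ (balanced T (end + L))) (≡⇒≤ (stream-flow end N 0≤T))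

      optimum : ∃[ v ] (IsOptimalCost finalInput v × 0# ≤ v × v ≤ offlineBound)
      optimum = let (S , cost≡) = offline final-ordered final-fits final-early final-compatible
                    (v , optimal , 0≤v , v≤U) = optimalCost S cost≡
                in v , optimal , 0≤v , ≤-trans v≤U offline-cost

      private
        open OnlineAlgorithm ALG using (run)

        final-remaining : ∀ q → workOf ALG μ 1<μ final-ordered q T + δ ≤ Job.processing
            (lookup (jobs final) q)
        final-remaining q = remaining-part (splitView entries q)
          where
          remaining-part : ∀ {q} → SplitView entries (stream N 0≤T) q →
                           workOf ALG μ 1<μ final-ordered q T + δ ≤ Job.processing
                               (lookup (jobs final) q)
          remaining-part (old q) = subst₂ (λ x j → x + δ ≤ Job.processing j)
            (sym (same-work-left ALG μ 1<μ stage final-ordered stream-late q))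
                (sym (lookup-left entries q)) (remaining q)
          remaining-part (new q) = subst (λ x → x + δ ≤ Job.processing
              (lookup (jobs final) (right entries q)))
            (sym (ScheduleProperties.work-unreleased (run finalInput) (right entries q) 0≤T
              (subst (λ j → T ≤ Job.release j) (sym job≡) (at-All stream-late q))))
            (subst (λ j → 0# + δ ≤ Job.processing j) (sym job≡) (at-All {λ e → 0# + δ ≤ processing e}
              (All.map (λ { (inStream _ refl _ _) → ≡⇒≤ (ring (δ ∷ []) (λ δ → ∙0 ⊕ δ ,
                δ)) }) in-final) q))
            where
            job≡ : lookup (jobs final) (right entries q) ≡ job (at (stream N 0≤T) q)
            job≡ = trans (lookup-right entries q) (lookup-jobs (stream N 0≤T) q)

        offsets : Carrier
        offsets = sumOver (λ e → T - release e) final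

        final-size : fromℕ (length (jobs final)) ≡ k * (1# + 1#) + n
        final-size = trans (size≡sumOver final) (trans (sumOver-++ (λ _ → 1#) entries)
          (cong₂ _+_ (trans (sumOver-slots entries) (balanced 1# 1#)) (stream-size N 0≤T)))
          where
          sumOver-slots : ∀ E → sumOver (λ _ → 1#) E ≡ sumOver (bySlot 1# 1#) E
          sumOver-slots [] = refl
          sumOver-slots (entry _ (fixed _) ∷ E)    = cong (1# +_) (sumOver-slots E)
          sumOver-slots (entry _ (deferred _) ∷ E) = cong (1# +_) (sumOver-slots E)

        offsets-bound : n * δ - n * n * δ ≤ offsets + offsets
        offsets-bound =
          lin (sumOver (λ e → T - release e) entries ∷
            sumOver (λ e → T - release e) (stream N 0≤T) ∷ offsets ∷ n ∷ δ ∷ [])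
            (λ a b offsets n δ → a ⊕ b ≲ offsets ⇒ a ⊕ b ≲ offsets ⇒ n ⊗ δ ⊖′ n ⊗ n ⊗ δ ≲ b ⊕ b ⇒
            ∙0 ≲ a ⇒ ∙0 ≲ a ⇒ ⊢ n ⊗ δ ⊖′ n ⊗ n ⊗ δ ≲ offsets ⊕ offsets)
            (≡⇒≤ (sym (sumOver-++ (λ e → T - release e) entries)))
            (≡⇒≤ (sym (sumOver-++ (λ e → T - release e) entries))) (≡⇒≤ (sym (stream-offset N 0≤T)))
            (sumOver-nonneg early) (sumOver-nonneg early)
          where
          sumOver-nonneg : ∀ {E} → All (AtMost T) E → 0# ≤ sumOver (λ e → T - release e) E
          sumOver-nonneg [] = ≤-refl
          sumOver-nonneg {e ∷ E} (r≤T ∷ rs) = lin (release e ∷ T ∷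
            sumOver (λ e → T - release e) E ∷ []) (λ a T b → a ≲ T ⇒ ∙0 ≲ b ⇒ ⊢ ∙0 ≲ T ⊖′ a ⊕ b) r≤T
            (sumOver-nonneg rs)

      onlineBound : Carrier
      onlineBound = (k + k + 1#) * (n * δ)

      online-cost : ∀ (c : Fin (length (jobs final)) → Carrier) →
          (∀ q → Schedule.completion (run finalInput) q ≡ [ c q ]) →
                    onlineBound ≤ sum (λ q → c q - Input.release finalInput q)
      online-cost c completed = halve-≤
        (lin (k ∷ n ∷ δ ∷ D ∷ offsets ∷ sum (λ q → c q - Input.release finalInput q) ∷ [])
          (λ k n δ D offsets a → (k ⊗ (∙1 ⊕ ∙1) ⊕ n) ⊗ ((k ⊗ (∙1 ⊕ ∙1) ⊕ n) ⊗ δ ⊕ δ) ≲ D ⊕ D ⇒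
          D ⊕ offsets ≲ a ⇒ D ⊕ offsets ≲ a ⇒ n ⊗ δ ⊖′ n ⊗ n ⊗ δ ≲ offsets ⊕ offsets ⇒
          ∙0 ≲ k ⊗ (k ⊗ δ) ⇒ ∙0 ≲ k ⊗ (k ⊗ δ) ⇒ ∙0 ≲ k ⊗ (k ⊗ δ) ⇒ ∙0 ≲ k ⊗ (k ⊗ δ) ⇒ ∙0 ≲ k ⊗ δ ⇒
          ∙0 ≲ k ⊗ δ ⇒ ⊢ (k ⊕ k ⊕ ∙1) ⊗ (n ⊗ δ) ⊕ (k ⊕ k ⊕ ∙1) ⊗ (n ⊗ δ) ≲ a ⊕ a) size-bound
          (≡⇒≤ (sym split)) (≡⇒≤ (sym split)) offsets-bound k²δ≥0 k²δ≥0 k²δ≥0 k²δ≥0 kδ≥0 kδ≥0)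
        where
        D : Carrier
        D = sum (λ q → c q - T)

        kδ≥0 : 0# ≤ k * δ
        kδ≥0 = lin (k ∷ δ ∷ []) (λ k δ → k ⊗ ∙0 ≲ k ⊗ δ ⇒ ⊢ ∙0 ≲ k ⊗ δ)
          (*-monoˡ-≤ (fromℕ≥0 K) (<⇒≤ 0<δ))

        k²δ≥0 : 0# ≤ k * (k * δ)
        k²δ≥0 = lin (k ∷ δ ∷ []) (λ k δ → k ⊗ ∙0 ≲ k ⊗ (k ⊗ δ) ⇒ ⊢ ∙0 ≲ k ⊗ (k ⊗ δ))
          (*-monoˡ-≤ (fromℕ≥0 K) kδ≥0)

        size-bound : (k * (1# + 1#) + n) * ((k * (1# + 1#) + n) * δ + δ) ≤ D + D
        size-bound = subst (λ m → m * (m * δ + δ) ≤ D + D) final-size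
          (ScheduleCosts.completions-bound (run finalInput) completed 0≤T 0<δ final-remaining)

        split : sum (λ q → c q - Input.release finalInput q) ≡ D + offsets
        split = trans (sum-cong-≗ (λ q → trans (cong (λ j → c q - Job.release j) (lookup-jobs final q))
                  (ring (c q ∷ release (at final q) ∷ T ∷ []) (λ a b T → a ⊖′ b ,
                    a ⊖′ T ⊕ (T ⊖′ b)))))
                (trans (∑-distrib-+ (λ q → c q - T) (λ q → T - release (at final q)))
                  (cong (D +_) (sum-at (λ e → T - release e) final)))

      online-cost-exceeds : ∀ {x} → x < onlineBound → [ x ] <⁺ OnlineAlgorithm.cost ALG finalInput
      online-cost-exceeds {x} x<b = [
          (λ ∞ → subst ([ x ] <⁺_) (sym ∞) [ x ]<⊤⁺)
        , (λ (c , completed) → subst ([ x ] <⁺_) (sym (costSum-finite _ _ c completed))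
            [ <-≤-trans x<b (online-cost c completed) ])
        ]′ (costSum-cases (Schedule.completion (run finalInput)) (Input.release finalInput))

    -- With K stages the ratio of the costs tends to (2K + 1) / (K + 1) as the
    -- length of the stream grows.
    lower-bound : ∀ c → c < 1# + 1# →
      ∃[ Q ] (Robust μ Q × ∃[ v ] (IsOptimalCost Q v × [ c * v ] <⁺ OnlineAlgorithm.cost ALG Q))
    lower-bound c c<2 = finalInput stage N , final-robust stage N , v , optimal ,
      online-cost-exceeds stage N (≤-<-trans cv≤c⁺U c⁺U<bound)
      where
      maximum : ∃[ m ] (c ≤ m × 0# ≤ m × m < 1# + 1#)
      maximum = [ (λ 0≤c → c , ≤-refl , 0≤c , c<2)
                , (λ c≤0 → 0# , c≤0 , ≤-refl , (lin ([]) (∙0 ≺ ∙1 ⇒ ∙0 ≺ ∙1 ⇒ ⊢ ∙0 ≺ ∙1 ⊕ ∙1) 0<1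
                  0<1)) ]′ (total 0# c)

      c⁺ : Carrier
      c⁺ = proj₁ maximum

      0≤c⁺ : 0# ≤ c⁺
      0≤c⁺ = proj₁ (proj₂ (proj₂ maximum))

      choose-K : ∃[ K ] c⁺ - 1# < fromℕ K * (1# + 1# - c⁺)
      choose-K = archimedean-* (lin (c⁺ ∷ []) (λ a → a ≺ ∙1 ⊕ ∙1 ⇒ ⊢ ∙0 ≺ ∙1 ⊕ ∙1 ⊖′ a)
        (proj₂ (proj₂ (proj₂ maximum)))) (c⁺ - 1#)

      K : ℕ
      K = proj₁ choose-K

      k : Carrier
      k = fromℕ K

      stage : Stage ALG μ 1<μ K
      stage = stages ALG μ 1<μ K

      open Stage stage using (T; L) renaming (ρ to δ; 0<ρ to 0<δ)

      excess : Carrier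
      excess = (k + k + 1#) - c⁺ * (k + 1#)

      0<excess : 0# < excess
      0<excess = lin (c⁺ ∷ k ∷ []) (λ a k → a ⊖′ ∙1 ≺ k ⊗ (∙1 ⊕ ∙1 ⊖′ a) ⇒
        ⊢ ∙0 ≺ k ⊕ k ⊕ ∙1 ⊖′ a ⊗ (k ⊕ ∙1)) (proj₂ choose-K)

      choose-N : ∃[ N ] c⁺ * (k * (T + T + L)) < fromℕ N * (δ * excess)
      choose-N = archimedean-* (*-pos 0<δ 0<excess) (c⁺ * (k * (T + T + L)))

      N : ℕ
      N = proj₁ choose-N

      v : Carrier
      v = proj₁ (optimum stage N)

      optimal : IsOptimalCost (finalInput stage N) v
      optimal = proj₁ (proj₂ (optimum stage N))

      0≤v : 0# ≤ v
      0≤v = proj₁ (proj₂ (proj₂ (optimum stage N)))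

      v≤U : v ≤ offlineBound stage N
      v≤U = proj₂ (proj₂ (proj₂ (optimum stage N)))

      cv≤c⁺U : c * v ≤ c⁺ * offlineBound stage N
      cv≤c⁺U = lin (v ∷ c ∷ c⁺ ∷ offlineBound stage N ∷ []) (λ v c a b → v ⊗ c ≲ v ⊗ a ⇒
        a ⊗ v ≲ a ⊗ b ⇒ ⊢ c ⊗ v ≲ a ⊗ b) (*-monoˡ-≤ 0≤v (proj₁ (proj₂ maximum)))
        (*-monoˡ-≤ 0≤c⁺ v≤U)

      c⁺U<bound : c⁺ * offlineBound stage N < onlineBound stage N
      c⁺U<bound = lin (c⁺ ∷ k ∷ T ∷ L ∷ fromℕ N ∷ δ ∷ [])
        (λ a k T L b δ → a ⊗ (k ⊗ (T ⊕ T ⊕ L)) ≺ b ⊗ (δ ⊗ (k ⊕ k ⊕ ∙1 ⊖′ a ⊗ (k ⊕ ∙1))) ⇒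
        ⊢ a ⊗ (k ⊗ (T ⊕ (T ⊕ b ⊗ δ ⊕ L)) ⊕ b ⊗ δ) ≺ (k ⊕ k ⊕ ∙1) ⊗ (b ⊗ δ)) (proj₂ choose-N)

theoremC1 : (ℝ : CompleteOrderedField) →
  let open CompleteOrderedField ℝ
      open SPPT ℝ in
  ∀ μ → 1# < μ →
  (ALG : OnlineAlgorithm) →
  ∀ c → c < 1# + 1# →
  ∃[ Q ] (Robust μ Q ×
    ∃[ v ] (IsOptimalCost Q v × [ c * v ] <⁺ OnlineAlgorithm.cost ALG Q))
theoremC1 ℝ μ 1<μ ALG = LowerBound.lower-bound ℝ ALG μ 1<μ
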